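{- Let $p$ be an odd prime and let $\alpha \in \mathbb{F}_p$ be a quadratic non-residue if $p \equiv 1 \pmod 4$, and a nonzero quadratic residue otherwise. Then the set $$A = \{(x_1,x_2,x_3) \in \mathbb{F}_p^3 : x_1^2 + x_2^2 + x_3^2 = \alpha\}$$ is a $C_3[3]$-set in the (additive) group $\mathbb{F}_p^3$, and $|A| \geq p^2 - p$.
   Context: Let $\Gamma$ be an abelian group and $g \geq h \geq 2$ integers. A set $A \subset \Gamma$ is a $C_h[g]$-set if, for any set $X \subset \Gamma$ with $|X| = h$ and any set $\{k_1,\dots,k_g\} \subset \Gamma$ of $g$ distinct elements, at least one of the translates $X + k_i := \{x + k_i : x \in X\}$ is not contained in $A$. Here $g=h=3$. -}

module Defs where

open import Algebra.Bundles using (AbelianGroup; CommutativeRing)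
open import Algebra.Construct.DirectProduct using (abelianGroup)
open import Data.Fin.Base using (Fin; toℕ)
open import Data.Fin.Properties using (toℕ-fromℕ<; toℕ-injective; toℕ<n; toℕ≤n)
open import Data.Nat.Base as ℕ using (ℕ; NonZero; _%_)
open import Data.Nat.DivMod
  using (_mod_; m%n<n; m%n%n≡m%n; n%n≡0; m<n⇒m%n≡m; %-distribˡ-+; %-distribˡ-*)
import Data.Nat.Properties as ℕ
open import Data.Product.Base using (_×_; _,_; Σ-syntax; ∃-syntax)
open import Function.Bundles using (_⇔_)
open import Function.Definitions using (Injective)
open import Level using (Level; _⊔_; suc; 0ℓ)
open import Relation.Binary.Bundles using (Setoid)
open import Relation.Binary.PropositionalEquality
  using (_≡_; sym; trans; cong; cong₂; isEquivalence; module ≡-Reasoning)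
open import Relation.Nullary.Negation.Core using (¬_)
open import Relation.Unary using (Pred; _∈_; _⊆_)

module _ (n : ℕ) .{{_ : NonZero n}} where

  private
    _+_ _*_ : Fin n → Fin n → Fin n
    x + y = (toℕ x ℕ.+ toℕ y) mod n
    x * y = (toℕ x ℕ.* toℕ y) mod n

    -_ : Fin n → Fin n
    - x = (n ℕ.∸ toℕ x) mod n

    0# 1# : Fin n
    0# = 0 mod n
    1# = 1 mod n

    toℕ-mod : ∀ m → toℕ (m mod n) ≡ m % n
    toℕ-mod m = toℕ-fromℕ< (m%n<n m n)

    mod-cong : ∀ {a b} → a % n ≡ b % n → a mod n ≡ b mod n
    mod-cong {a} {b} eq =
      toℕ-injective (trans (toℕ-mod a) (trans eq (sym (toℕ-mod b))))

    mod-toℕ : ∀ x → toℕ x mod n ≡ x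
    mod-toℕ x = toℕ-injective (trans (toℕ-mod (toℕ x)) (m<n⇒m%n≡m (toℕ<n x)))

    mod-+ : ∀ a b → (a mod n) + (b mod n) ≡ (a ℕ.+ b) mod n
    mod-+ a b rewrite toℕ-mod a | toℕ-mod b =
      mod-cong (sym (%-distribˡ-+ a b n))

    mod-* : ∀ a b → (a mod n) * (b mod n) ≡ (a ℕ.* b) mod n
    mod-* a b rewrite toℕ-mod a | toℕ-mod b =
      mod-cong (sym (%-distribˡ-* a b n))

    mod-+ˡ : ∀ a y → (a mod n) + y ≡ (a ℕ.+ toℕ y) mod n
    mod-+ˡ a y = trans (cong ((a mod n) +_) (sym (mod-toℕ y))) (mod-+ a (toℕ y))

    mod-*ˡ : ∀ a y → (a mod n) * y ≡ (a ℕ.* toℕ y) mod n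
    mod-*ˡ a y = trans (cong ((a mod n) *_) (sym (mod-toℕ y))) (mod-* a (toℕ y))

    +-comm : ∀ x y → x + y ≡ y + x
    +-comm x y = cong (_mod n) (ℕ.+-comm (toℕ x) (toℕ y))

    *-comm : ∀ x y → x * y ≡ y * x
    *-comm x y = cong (_mod n) (ℕ.*-comm (toℕ x) (toℕ y))

    +-assoc : ∀ x y z → (x + y) + z ≡ x + (y + z)
    +-assoc x y z = begin
      (x + y) + z                          ≡⟨ mod-+ˡ (toℕ x ℕ.+ toℕ y) z ⟩
      (toℕ x ℕ.+ toℕ y ℕ.+ toℕ z) mod n    ≡⟨ cong (_mod n) (ℕ.+-assoc (toℕ x) (toℕ y) (toℕ z)) ⟩
      (toℕ x ℕ.+ (toℕ y ℕ.+ toℕ z)) mod n  ≡⟨ cong (_mod n) (ℕ.+-comm (toℕ x) (toℕ y ℕ.+ toℕ z)) ⟩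
      (toℕ y ℕ.+ toℕ z ℕ.+ toℕ x) mod n    ≡⟨ mod-+ˡ (toℕ y ℕ.+ toℕ z) x ⟨
      (y + z) + x                          ≡⟨ +-comm (y + z) x ⟩
      x + (y + z)                          ∎
      where open ≡-Reasoning

    *-assoc : ∀ x y z → (x * y) * z ≡ x * (y * z)
    *-assoc x y z = begin
      (x * y) * z                          ≡⟨ mod-*ˡ (toℕ x ℕ.* toℕ y) z ⟩
      (toℕ x ℕ.* toℕ y ℕ.* toℕ z) mod n    ≡⟨ cong (_mod n) (ℕ.*-assoc (toℕ x) (toℕ y) (toℕ z)) ⟩
      (toℕ x ℕ.* (toℕ y ℕ.* toℕ z)) mod n  ≡⟨ cong (_mod n) (ℕ.*-comm (toℕ x) (toℕ y ℕ.* toℕ z)) ⟩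
      (toℕ y ℕ.* toℕ z ℕ.* toℕ x) mod n    ≡⟨ mod-*ˡ (toℕ y ℕ.* toℕ z) x ⟨
      (y * z) * x                          ≡⟨ *-comm (y * z) x ⟩
      x * (y * z)                          ∎
      where open ≡-Reasoning

    +-identityˡ : ∀ x → 0# + x ≡ x
    +-identityˡ x = trans (mod-+ˡ 0 x) (mod-toℕ x)

    *-identityˡ : ∀ x → 1# * x ≡ x
    *-identityˡ x =
      trans (mod-*ˡ 1 x) (trans (cong (_mod n) (ℕ.*-identityˡ (toℕ x))) (mod-toℕ x))

    -‿inverseˡ : ∀ x → (- x) + x ≡ 0#
    -‿inverseˡ x = begin
      (- x) + x                      ≡⟨ mod-+ˡ (n ℕ.∸ toℕ x) x ⟩
      (n ℕ.∸ toℕ x ℕ.+ toℕ x) mod n  ≡⟨ cong (_mod n) (ℕ.m∸n+n≡m (toℕ≤n x)) ⟩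
      n mod n                        ≡⟨ mod-cong (trans (n%n≡0 n) (sym (m<n⇒m%n≡m (ℕ.>-nonZero⁻¹ n)))) ⟩
      0#                             ∎
      where open ≡-Reasoning

    distribʳ : ∀ x y z → (y + z) * x ≡ (y * x) + (z * x)
    distribʳ x y z = begin
      (y + z) * x                                    ≡⟨ mod-*ˡ (toℕ y ℕ.+ toℕ z) x ⟩
      ((toℕ y ℕ.+ toℕ z) ℕ.* toℕ x) mod n            ≡⟨ cong (_mod n) (ℕ.*-distribʳ-+ (toℕ x) (toℕ y) (toℕ z)) ⟩
      (toℕ y ℕ.* toℕ x ℕ.+ toℕ z ℕ.* toℕ x) mod n    ≡⟨ mod-+ (toℕ y ℕ.* toℕ x) (toℕ z ℕ.* toℕ x) ⟨
      (y * x) + (z * x)                              ∎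
      where open ≡-Reasoning

  ℤ/ : CommutativeRing 0ℓ 0ℓ
  ℤ/ = record
    { Carrier = Fin n
    ; _≈_ = _≡_
    ; _+_ = _+_
    ; _*_ = _*_
    ; -_ = -_
    ; 0# = 0#
    ; 1# = 1#
    ; isCommutativeRing = record
      { isRing = record
        { +-isAbelianGroup = record
          { isGroup = record
            { isMonoid = record
              { isSemigroup = record
                { isMagma = record
                  { isEquivalence = isEquivalence
                  ; ∙-cong = cong₂ _+_
                  }
                ; assoc = +-assoc
                }
              ; identity = +-identityˡ
                         , λ x → trans (+-comm x 0#) (+-identityˡ x)
              }
            ; inverse = -‿inverseˡ
                      , λ x → trans (+-comm x (- x)) (-‿inverseˡ x)
            ; ⁻¹-cong = cong -_
            }
          ; comm = +-comm
          }
        ; *-cong = cong₂ _*_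
        ; *-assoc = *-assoc
        ; *-identity = *-identityˡ
                     , λ x → trans (*-comm x 1#) (*-identityˡ x)
        ; distrib = (λ x y z → trans (*-comm x (y + z))
                      (trans (distribʳ x y z) (cong₂ _+_ (*-comm y x) (*-comm z x))))
                  , distribʳ
        }
      ; *-comm = *-comm
      }
    }

module _ {c ℓ : Level} (S : Setoid c ℓ) where
  open Setoid S

  HasCardinality : ∀ {a} → Pred Carrier a → ℕ → Set (c ⊔ ℓ ⊔ a)
  HasCardinality A n =
    Σ[ e ∈ (Fin n → Carrier) ]
      Injective _≡_ _≈_ e × (∀ x → x ∈ A ⇔ (∃[ i ] x ≈ e i))

  CardinalityAtLeast : ∀ {a} → Pred Carrier a → ℕ → Set (c ⊔ ℓ ⊔ a)
  CardinalityAtLeast A m = ∃[ n ] HasCardinality A n × n ℕ.≥ m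

module _ {c ℓ : Level} (Γ : AbelianGroup c ℓ) where
  open AbelianGroup Γ

  Translate : ∀ {a} → Pred Carrier a → Carrier → Pred Carrier (c ⊔ ℓ ⊔ a)
  Translate X k y = ∃[ x ] x ∈ X × y ≈ x ∙ k

  -- X ranges over predicates of level ℓ without loss of generality: a set
  -- enumerated by e is equivalent to the predicate λ x → ∃[ i ] x ≈ e i.
  IsC[_,_]-Set : ∀ {a} → ℕ → ℕ → Pred Carrier a → Set (c ⊔ suc ℓ ⊔ a)
  IsC[ h , g ]-Set A =
    ∀ (X : Pred Carrier ℓ) → HasCardinality setoid X h →
    ∀ (k : Fin g → Carrier) → Injective _≡_ _≈_ k →
    ∃[ i ] ¬ (Translate X (k i) ⊆ A)

module _ {c ℓ : Level} (R : CommutativeRing c ℓ) where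
  open CommutativeRing R

  QuadraticResidue : Pred Carrier (c ⊔ ℓ)
  QuadraticResidue α = ∃[ x ] x * x ≈ α

  Cube : AbelianGroup c ℓ
  Cube = abelianGroup +-abelianGroup (abelianGroup +-abelianGroup +-abelianGroup)

  Sphere : Carrier → Pred (AbelianGroup.Carrier Cube) ℓ
  Sphere α (x₁ , x₂ , x₃) = x₁ * x₁ + x₂ * x₂ + x₃ * x₃ ≈ α

{-# OPTIONS --safe #-}

-- In either residue class of p modulo 4, - α is not a square.  Indeed - 1 is a square iff p ≡ 1
-- modulo 4, by counting the fixed points of x ↦ 1/x on the (p - 1)/2 classes {x, - x}.
-- If all x i + k j lie on the sphere, the differences x i - x 0 are orthogonal to the differences
-- k j - k 0, so in dimension 3 one of the two families spans a line, and a translate of the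
-- corresponding triple consists of three collinear points of the sphere.  Then the whole line lies
-- on the sphere, and Lagrange's identity (a₂u₃ - a₃u₂)² = - α u₁² for its direction u makes - α a
-- square.
-- For the cardinality, the form x₁² + x₂² + x₃² is isotropic, hence equivalent to y z - s², and
-- y z = α + s² ≠ 0 is solved by exactly p (p - 1) triples.
module Submission where

open import Defs
open import Algebra.Bundles using (AbelianGroup; CommutativeRing)
import Algebra.Properties.AbelianGroup
import Algebra.Properties.CommutativeMonoid.Sum
import Algebra.Properties.CommutativeSemigroup
import Algebra.Properties.Group
import Algebra.Properties.Ring
import Algebra.Properties.Semiring.Mult.TCOptimised
import Algebra.Solver.Ring
open import Algebra.Solver.Ring.AlmostCommutativeRing using (fromCommutativeRing; _-Raw-AlmostCommutative⟶_)
open import Data.Fin.Base as Fin using (Fin; zero; suc; toℕ; fromℕ<; join; splitAt; punchIn; punchOut; remQuot; combine)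
open import Data.Fin.Patterns using (0F; 1F; 2F)
open import Data.Fin.Permutation using (permutation)
open import Data.Fin.Properties
  using ( _≟_; _<?_; <-cmp; <⇒≢; all?; any?; ¬∀⟶∃¬; pigeonhole; join-splitAt; punchInᵢ≢i; punchIn-injective
        ; punchIn-punchOut; remQuot-combine; combine-remQuot; toℕ-fromℕ<; toℕ-injective; toℕ<n; suc-injective )
open import Data.Integer.Base as ℤ using (ℤ; -[1+_]) renaming (+_ to pos)
import Data.Integer.Properties as ℤ
import Data.Maybe.Base as Maybe
open import Data.Nat.Base as ℕ using (ℕ; zero; suc; NonZero; _%_; _^_; _∸_; _≤_; _<_; s≤s; z≤n)
open import Data.Nat.Coprimality using (prime⇒coprime; coprime-Bézout)
open import Data.Nat.Divisibility using (_∤_; m%n≡0⇒n∣m)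
open import Data.Nat.DivMod
  using (_mod_; _/_; m%n<n; m<n⇒m%n≡m; %-distribˡ-+; %-distribˡ-*; [m+kn]%n≡m%n; m*n%n≡0; m≡m%n+[m/n]*n)
open import Data.Nat.GCD using (module Bézout)
open import Data.Nat.Primality using (Prime; prime⇒nonTrivial)
import Data.Nat.Properties as ℕ
open import Data.Nat.Solver using (module +-*-Solver)
open import Data.Product.Base using (_×_; _,_; proj₁; proj₂; ∃-syntax; uncurry)
open import Data.Sum.Base using (_⊎_; inj₁; inj₂; [_,_]′)
open import Function.Base using (_∘_)
open import Function.Bundles using (Equivalence; mk⇔)
open import Function.Definitions using (Injective)
open import Level using (Level; _⊔_)
open import Relation.Binary.Definitions using (Decidable; tri<; tri≈; tri>)
open import Relation.Binary.PropositionalEquality as ≡ using (_≡_; _≢_; module ≡-Reasoning)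
import Relation.Binary.Reasoning.Setoid
open import Relation.Nullary.Decidable using (Dec; yes; no; _×-dec_; dec⇒maybe)
open import Relation.Nullary.Negation using (¬_; contradiction)
import Relation.Unary as Unary

-- Polynomial identities with integer coefficients in a commutative ring.

module IntegerCoefficients {c ℓ : Level} (R : CommutativeRing c ℓ) where
  open CommutativeRing R
  open Algebra.Properties.AbelianGroup +-abelianGroup using (ε⁻¹≈ε; ⁻¹-involutive; ⁻¹-∙-comm)
  open Algebra.Properties.Ring ring using (-‿distribˡ-*; -‿distribʳ-*)
  open Algebra.Properties.CommutativeSemigroup +-commutativeSemigroup using (interchange)
  open Algebra.Properties.Semiring.Mult.TCOptimised semiring using (1+×; ×-homo-+; ×1-homo-*) renaming (_×_ to _×ₙ_)
  open Relation.Binary.Reasoning.Setoid setoid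

  -- With the optimised multiple the constants 0, 1 and 2 evaluate to `0#`, `1#` and `1# + 1#` by
  -- computation, so solved identities match statements written with `1# + 1#`.
  fromℕ : ℕ → Carrier
  fromℕ n = n ×ₙ 1#

  fromℤ : ℤ → Carrier
  fromℤ (pos n)  = fromℕ n
  fromℤ -[1+ n ] = - fromℕ (suc n)

  fromℤ-⊖ : ∀ m n → fromℤ (m ℤ.⊖ n) ≈ fromℕ m - fromℕ n
  fromℤ-⊖ zero    zero    = sym (-‿inverseʳ 0#)
  fromℤ-⊖ zero    (suc n) = sym (+-identityˡ _)
  fromℤ-⊖ (suc m) zero    = sym (trans (+-congˡ ε⁻¹≈ε) (+-identityʳ _))
  fromℤ-⊖ (suc m) (suc n) = begin
    fromℤ (suc m ℤ.⊖ suc n)              ≡⟨ ≡.cong fromℤ (ℤ.[1+m]⊖[1+n]≡m⊖n m n) ⟩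
    fromℤ (m ℤ.⊖ n)                      ≈⟨ fromℤ-⊖ m n ⟩
    fromℕ m - fromℕ n                    ≈⟨ +-identityˡ _ ⟨
    -- Inserting 1 - 1 supplies the unit that each of m and n gains.
    0# + (fromℕ m - fromℕ n)             ≈⟨ +-congʳ (-‿inverseʳ 1#) ⟨
    (1# - 1#) + (fromℕ m - fromℕ n)      ≈⟨ interchange _ _ _ _ ⟩
    (1# + fromℕ m) + (- 1# + - fromℕ n)  ≈⟨ +-congˡ (⁻¹-∙-comm 1# (fromℕ n)) ⟩
    (1# + fromℕ m) - (1# + fromℕ n)      ≈⟨ +-cong (1+× m 1#) (-‿cong (1+× n 1#)) ⟨
    fromℕ (suc m) - fromℕ (suc n)        ∎

  fromℤ-+ : ∀ i j → fromℤ (i ℤ.+ j) ≈ fromℤ i + fromℤ j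
  fromℤ-+ (pos m)  (pos n)  = ×-homo-+ 1# m n
  fromℤ-+ (pos m)  -[1+ n ] = fromℤ-⊖ m (suc n)
  fromℤ-+ -[1+ m ] (pos n)  = trans (fromℤ-⊖ n (suc m)) (+-comm _ _)
  fromℤ-+ -[1+ m ] -[1+ n ] = begin
    - fromℕ (suc (suc (m ℕ.+ n)))        ≡⟨ ≡.cong (λ k → - fromℕ (suc k)) (ℕ.+-suc m n) ⟨
    - fromℕ (suc m ℕ.+ suc n)            ≈⟨ -‿cong (×-homo-+ 1# (suc m) (suc n)) ⟩
    - (fromℕ (suc m) + fromℕ (suc n))    ≈⟨ ⁻¹-∙-comm _ _ ⟨
    - fromℕ (suc m) + - fromℕ (suc n)    ∎

  fromℤ-neg : ∀ i → fromℤ (ℤ.- i) ≈ - fromℤ i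
  fromℤ-neg (pos zero)    = sym ε⁻¹≈ε
  fromℤ-neg (pos (suc n)) = refl
  fromℤ-neg -[1+ n ]      = sym (⁻¹-involutive _)

  fromℤ-pos* : ∀ m j → fromℤ (pos m ℤ.* j) ≈ fromℕ m * fromℤ j
  fromℤ-pos* m (pos n) = begin
    fromℤ (pos m ℤ.* pos n)  ≡⟨ ≡.cong fromℤ (ℤ.pos-* m n) ⟨
    fromℕ (m ℕ.* n)          ≈⟨ ×1-homo-* m n ⟩
    fromℕ m * fromℕ n        ∎
  fromℤ-pos* m -[1+ n ] = begin
    fromℤ (pos m ℤ.* -[1+ n ])             ≡⟨ ≡.cong fromℤ (ℤ.neg-distribʳ-* (pos m) (pos (suc n))) ⟨
    fromℤ (ℤ.- (pos m ℤ.* pos (suc n)))    ≈⟨ fromℤ-neg (pos m ℤ.* pos (suc n)) ⟩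
    - fromℤ (pos m ℤ.* pos (suc n))        ≈⟨ -‿cong (fromℤ-pos* m (pos (suc n))) ⟩
    - (fromℕ m * fromℕ (suc n))            ≈⟨ -‿distribʳ-* _ _ ⟩
    fromℕ m * - fromℕ (suc n)              ∎

  fromℤ-* : ∀ i j → fromℤ (i ℤ.* j) ≈ fromℤ i * fromℤ j
  fromℤ-* (pos m) j = fromℤ-pos* m j
  fromℤ-* -[1+ m ] j = begin
    fromℤ (-[1+ m ] ℤ.* j)           ≡⟨ ≡.cong fromℤ (ℤ.neg-distribˡ-* (pos (suc m)) j) ⟨
    fromℤ (ℤ.- (pos (suc m) ℤ.* j))  ≈⟨ fromℤ-neg (pos (suc m) ℤ.* j) ⟩
    - fromℤ (pos (suc m) ℤ.* j)      ≈⟨ -‿cong (fromℤ-pos* (suc m) j) ⟩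
    - (fromℕ (suc m) * fromℤ j)      ≈⟨ -‿distribˡ-* _ _ ⟩
    - fromℕ (suc m) * fromℤ j        ∎

  homomorphism : ℤ.+-*-rawRing -Raw-AlmostCommutative⟶ fromCommutativeRing R
  homomorphism = record
    { ⟦_⟧    = fromℤ
    ; +-homo = fromℤ-+
    ; *-homo = fromℤ-*
    ; -‿homo = fromℤ-neg
    ; 0-homo = refl
    ; 1-homo = refl
    }

  open Algebra.Solver.Ring ℤ.+-*-rawRing (fromCommutativeRing R) homomorphism
    -- Deciding equality of integer coefficients lets the normal form recognise terms that cancel.
    (λ i j → Maybe.map (λ i≡j → reflexive (≡.cong fromℤ i≡j)) (dec⇒maybe (i ℤ.≟ j))) public
    using (solve; _:=_; _:+_; _:*_; _:-_; :-_; con)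

-- Three-dimensional vectors over a field with decidable equality.

NonzeroInvertible : ∀ {c ℓ} → CommutativeRing c ℓ → Set (c ⊔ ℓ)
NonzeroInvertible R = ∀ x → x ≉ 0# → ∃[ y ] x * y ≈ 1#
  where open CommutativeRing R

module DiscreteField {c ℓ : Level} (R : CommutativeRing c ℓ)
  (_≟_ : Decidable (CommutativeRing._≈_ R)) (invert : NonzeroInvertible R) where

  open CommutativeRing R
  open Algebra.Properties.Group +-group using (∙-cancelʳ)
    renaming (x∙y⁻¹≈ε⇒x≈y to x-y≈0⇒x≈y; x≈y⇒x∙y⁻¹≈ε to x≈y⇒x-y≈0)
  open Relation.Binary.Reasoning.Setoid setoid
  open IntegerCoefficients R

  Vector : Set c
  Vector = Carrier × Carrier × Carrier

  infix  4 _≈ᵥ_ _≉ᵥ_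
  infixl 6 _+ᵥ_ _-ᵥ_
  infixl 7 _·_ _⋆_
  infix  7 _⨯_

  _≈ᵥ_ _≉ᵥ_ : Vector → Vector → Set ℓ
  (u₁ , u₂ , u₃) ≈ᵥ (v₁ , v₂ , v₃) = u₁ ≈ v₁ × u₂ ≈ v₂ × u₃ ≈ v₃
  u ≉ᵥ v = ¬ u ≈ᵥ v

  _+ᵥ_ _-ᵥ_ : Vector → Vector → Vector
  (u₁ , u₂ , u₃) +ᵥ (v₁ , v₂ , v₃) = u₁ + v₁ , u₂ + v₂ , u₃ + v₃
  (u₁ , u₂ , u₃) -ᵥ (v₁ , v₂ , v₃) = u₁ - v₁ , u₂ - v₂ , u₃ - v₃

  0ᵥ : Vector
  0ᵥ = 0# , 0# , 0#

  _·_ : Vector → Vector → Carrier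
  (u₁ , u₂ , u₃) · (v₁ , v₂ , v₃) = u₁ * v₁ + u₂ * v₂ + u₃ * v₃

  _⨯_ : Vector → Vector → Vector
  (u₁ , u₂ , u₃) ⨯ (v₁ , v₂ , v₃) =
    u₂ * v₃ - u₃ * v₂ , u₃ * v₁ - u₁ * v₃ , u₁ * v₂ - u₂ * v₁

  _⋆_ : Carrier → Vector → Vector
  c ⋆ (u₁ , u₂ , u₃) = c * u₁ , c * u₂ , c * u₃

  -- Both products are compatible with cyclic rotation, so an argument for a nonzero first
  -- coordinate carries over to the other two coordinates.
  rotate : Vector → Vector
  rotate (u₁ , u₂ , u₃) = u₂ , u₃ , u₁

  ≈ᵥ-refl : ∀ {u} → u ≈ᵥ u
  ≈ᵥ-refl = refl , refl , refl

  ≈ᵥ-sym : ∀ {u v} → u ≈ᵥ v → v ≈ᵥ u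
  ≈ᵥ-sym (p₁ , p₂ , p₃) = sym p₁ , sym p₂ , sym p₃

  ≈ᵥ-trans : ∀ {u v w} → u ≈ᵥ v → v ≈ᵥ w → u ≈ᵥ w
  ≈ᵥ-trans (p₁ , p₂ , p₃) (q₁ , q₂ , q₃) = trans p₁ q₁ , trans p₂ q₂ , trans p₃ q₃

  +ᵥ-congˡ : ∀ u {v w} → v ≈ᵥ w → u +ᵥ v ≈ᵥ u +ᵥ w
  +ᵥ-congˡ _ (p₁ , p₂ , p₃) = +-congˡ p₁ , +-congˡ p₂ , +-congˡ p₃

  +ᵥ-comm : ∀ u v → u +ᵥ v ≈ᵥ v +ᵥ u
  +ᵥ-comm _ _ = +-comm _ _ , +-comm _ _ , +-comm _ _

  x-y≈0⇒x≈ᵥy : ∀ u v → u -ᵥ v ≈ᵥ 0ᵥ → u ≈ᵥ v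
  x-y≈0⇒x≈ᵥy _ _ (p₁ , p₂ , p₃) = x-y≈0⇒x≈y _ _ p₁ , x-y≈0⇒x≈y _ _ p₂ , x-y≈0⇒x≈y _ _ p₃

  -ᵥ-cancelʳ : ∀ u v w → u -ᵥ w ≈ᵥ v -ᵥ w → u ≈ᵥ v
  -ᵥ-cancelʳ _ _ _ (p₁ , p₂ , p₃) = ∙-cancelʳ _ _ _ p₁ , ∙-cancelʳ _ _ _ p₂ , ∙-cancelʳ _ _ _ p₃

  ·-cong : ∀ {u u′ v v′} → u ≈ᵥ u′ → v ≈ᵥ v′ → u · v ≈ u′ · v′
  ·-cong (p₁ , p₂ , p₃) (q₁ , q₂ , q₃) =
    +-cong (+-cong (*-cong p₁ q₁) (*-cong p₂ q₂)) (*-cong p₃ q₃)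

  Sphere-resp : ∀ {α u v} → u ≈ᵥ v → Sphere R α u → Sphere R α v
  Sphere-resp u≈v u∈S = trans (sym (·-cong u≈v u≈v)) u∈S

  ·-rotate : ∀ u v → rotate u · rotate v ≈ u · v
  ·-rotate _ _ = trans (+-comm _ _) (sym (+-assoc _ _ _))

  ⋆-congʳ : ∀ {c d} u → c ≈ d → c ⋆ u ≈ᵥ d ⋆ u
  ⋆-congʳ _ c≈d = *-congʳ c≈d , *-congʳ c≈d , *-congʳ c≈d

  ⋆-congˡ : ∀ c {u v} → u ≈ᵥ v → c ⋆ u ≈ᵥ c ⋆ v
  ⋆-congˡ _ (p₁ , p₂ , p₃) = *-congˡ p₁ , *-congˡ p₂ , *-congˡ p₃

  ⋆-identity : ∀ u → 1# ⋆ u ≈ᵥ u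
  ⋆-identity _ = *-identityˡ _ , *-identityˡ _ , *-identityˡ _

  ⋆-assoc : ∀ c d u → (c * d) ⋆ u ≈ᵥ c ⋆ (d ⋆ u)
  ⋆-assoc _ _ _ = *-assoc _ _ _ , *-assoc _ _ _ , *-assoc _ _ _

  ⋆-zero : ∀ u → 0# ⋆ u ≈ᵥ 0ᵥ
  ⋆-zero _ = zeroˡ _ , zeroˡ _ , zeroˡ _

  -- Cancellation and square roots.

  x*y≈0⇒y≈0 : ∀ {x y} → x ≉ 0# → x * y ≈ 0# → y ≈ 0#
  x*y≈0⇒y≈0 {x} {y} x≉0 xy≈0 with x⁻¹ , xx⁻¹≈1 ← invert x x≉0 = begin
    y                ≈⟨ *-identityˡ y ⟨
    1# * y           ≈⟨ *-congʳ xx⁻¹≈1 ⟨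
    x * x⁻¹ * y      ≈⟨ solve 3 (λ x x⁻¹ y → x :* x⁻¹ :* y := x⁻¹ :* (x :* y)) refl x x⁻¹ y ⟩
    x⁻¹ * (x * y)    ≈⟨ *-congˡ xy≈0 ⟩
    x⁻¹ * 0#         ≈⟨ zeroʳ x⁻¹ ⟩
    0#               ∎

  -- In (x - y)(x + y) = 0 the first factor either vanishes or can be cancelled.
  x²≈y²⇒x≈±y : ∀ {x y} → x * x ≈ y * y → x ≈ y ⊎ x ≈ - y
  x²≈y²⇒x≈±y {x} {y} x²≈y² with (x - y) ≟ 0#
  ... | yes x-y≈0 = inj₁ (x-y≈0⇒x≈y x y x-y≈0)
  ... | no  x-y≉0 = inj₂ (begin
    x            ≈⟨ solve 2 (λ x y → x := (x :+ y) :- y) refl x y ⟩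
    (x + y) - y  ≈⟨ +-congʳ (x*y≈0⇒y≈0 x-y≉0 (begin
      (x - y) * (x + y)  ≈⟨ solve 2 (λ x y → (x :- y) :* (x :+ y) := x :* x :- y :* y) refl x y ⟩
      x * x - y * y      ≈⟨ x≈y⇒x-y≈0 x²≈y² ⟩
      0#                 ∎)) ⟩
    0# - y       ≈⟨ +-identityˡ (- y) ⟩
    - y          ∎)

  -- A root i of - 1 times a root s of - α is a root of α.
  -1∈QR∧-α∈QR⇒α∈QR : ∀ α → QuadraticResidue R (- 1#) → QuadraticResidue R (- α) → QuadraticResidue R α
  -1∈QR∧-α∈QR⇒α∈QR α (i , i²≈-1) (s , s²≈-α) = i * s , (begin
    i * s * (i * s)      ≈⟨ solve 2 (λ i s → i :* s :* (i :* s) := i :* i :* (s :* s)) refl i s ⟩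
    i * i * (s * s)      ≈⟨ *-cong i²≈-1 s²≈-α ⟩
    - 1# * - α           ≈⟨ solve 1 (λ α → :- con (pos 1) :* :- α := α) refl α ⟩
    α                    ∎)

  -- The quotient of a root of - α by a root of α squares to - 1.
  α∈QR∧-α∈QR⇒-1∈QR : ∀ α → α ≉ 0# → QuadraticResidue R α → QuadraticResidue R (- α) →
    QuadraticResidue R (- 1#)
  α∈QR∧-α∈QR⇒-1∈QR α α≉0 (t , t²≈α) (s , s²≈-α) = s * t⁻¹ , (begin
    s * t⁻¹ * (s * t⁻¹)          ≈⟨ solve 2 (λ s i → s :* i :* (s :* i) := s :* s :* (i :* i)) refl s t⁻¹ ⟩
    s * s * (t⁻¹ * t⁻¹)          ≈⟨ *-congʳ (trans s²≈-α (-‿cong (sym t²≈α))) ⟩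
    - (t * t) * (t⁻¹ * t⁻¹)      ≈⟨ solve 2 (λ t i → :- (t :* t) :* (i :* i) := :- (t :* i :* (t :* i))) refl t t⁻¹ ⟩
    - (t * t⁻¹ * (t * t⁻¹))      ≈⟨ -‿cong (*-cong tt⁻¹≈1 tt⁻¹≈1) ⟩
    - (1# * 1#)                  ≈⟨ -‿cong (*-identityˡ 1#) ⟩
    - 1#                         ∎)
    where
    t≉0 : t ≉ 0#
    t≉0 t≈0 = α≉0 (trans (sym t²≈α) (trans (*-congʳ t≈0) (zeroˡ t)))
    t⁻¹ = proj₁ (invert t t≉0)
    tt⁻¹≈1 = proj₂ (invert t t≉0)

  -- Parallel vectors and isotropic directions.

  ≉ᵥ0⇒component≉0 : ∀ u → u ≉ᵥ 0ᵥ →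
    proj₁ u ≉ 0# ⊎ proj₁ (rotate u) ≉ 0# ⊎ proj₁ (rotate (rotate u)) ≉ 0#
  ≉ᵥ0⇒component≉0 (u₁ , u₂ , u₃) u≉0 with u₁ ≟ 0# | u₂ ≟ 0# | u₃ ≟ 0#
  ... | no u₁≉0  | _         | _         = inj₁ u₁≉0
  ... | yes _    | no u₂≉0   | _         = inj₂ (inj₁ u₂≉0)
  ... | yes _    | yes _     | no u₃≉0   = inj₂ (inj₂ u₃≉0)
  ... | yes u₁≈0 | yes u₂≈0  | yes u₃≈0  = contradiction (u₁≈0 , u₂≈0 , u₃≈0) u≉0

  -- The first coordinate forces c = v₁ / u₁. The last two components of the cross product give u₁
  -- vᵢ = uᵢ v₁ for i = 2, 3, which is the claim there.
  ⨯≈0⇒multiple-pivot : ∀ u v → proj₁ u ≉ 0# → u ⨯ v ≈ᵥ 0ᵥ → ∃[ c ] v ≈ᵥ c ⋆ u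
  ⨯≈0⇒multiple-pivot (u₁ , u₂ , u₃) (v₁ , v₂ , v₃) u₁≉0 (_ , u₃v₁-u₁v₃≈0 , u₁v₂-u₂v₁≈0)
    with u₁⁻¹ , u₁u₁⁻¹≈1 ← invert u₁ u₁≉0 =
      u₁⁻¹ * v₁
    , component v₁ u₁ refl
    , component v₂ u₂ (x-y≈0⇒x≈y _ _ u₁v₂-u₂v₁≈0)
    , component v₃ u₃ (sym (x-y≈0⇒x≈y _ _ u₃v₁-u₁v₃≈0))
    where
    component : ∀ vᵢ uᵢ → u₁ * vᵢ ≈ uᵢ * v₁ → vᵢ ≈ u₁⁻¹ * v₁ * uᵢ
    component vᵢ uᵢ u₁vᵢ≈uᵢv₁ = begin
      vᵢ                 ≈⟨ *-identityˡ vᵢ ⟨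
      1# * vᵢ            ≈⟨ *-congʳ u₁u₁⁻¹≈1 ⟨
      u₁ * u₁⁻¹ * vᵢ     ≈⟨ solve 3 (λ x x⁻¹ y → x :* x⁻¹ :* y := x⁻¹ :* (x :* y)) refl u₁ u₁⁻¹ vᵢ ⟩
      u₁⁻¹ * (u₁ * vᵢ)   ≈⟨ *-congˡ u₁vᵢ≈uᵢv₁ ⟩
      u₁⁻¹ * (uᵢ * v₁)   ≈⟨ solve 3 (λ x y z → x :* (y :* z) := x :* z :* y) refl u₁⁻¹ uᵢ v₁ ⟩
      u₁⁻¹ * v₁ * uᵢ     ∎

  ⨯≈0⇒multiple : ∀ u v → u ≉ᵥ 0ᵥ → u ⨯ v ≈ᵥ 0ᵥ → ∃[ c ] v ≈ᵥ c ⋆ u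
  ⨯≈0⇒multiple u v u≉0 (e₁ , e₂ , e₃) =
    [ (λ u₁≉0 → ⨯≈0⇒multiple-pivot u v u₁≉0 (e₁ , e₂ , e₃))
    -- Rotating both factors rotates the cross product, so the three equations are only permuted,
    -- and the answer is permuted back.
    , [ (λ u₂≉0 → let c , p₂ , p₃ , p₁ = ⨯≈0⇒multiple-pivot (rotate u) (rotate v) u₂≉0 (e₂ , e₃ , e₁)
                  in c , p₁ , p₂ , p₃)
      , (λ u₃≉0 → let c , p₃ , p₁ , p₂ = ⨯≈0⇒multiple-pivot (rotate (rotate u)) (rotate (rotate v)) u₃≉0 (e₃ , e₁ , e₂)
                  in c , p₁ , p₂ , p₃)
      ]′
    ]′ (≉ᵥ0⇒component≉0 u u≉0)

  -- Expansion of the triple product: (u ⨯ v) ⨯ y = (u · y) v - (v · y) u. By rotation only the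
  -- first component has to be computed.
  [u⨯v]⨯y≈0 : ∀ u v y → u · y ≈ 0# → v · y ≈ 0# → (u ⨯ v) ⨯ y ≈ᵥ 0ᵥ
  [u⨯v]⨯y≈0 u v y u·y≈0 v·y≈0 =
      component u v y u·y≈0 v·y≈0
    , component (rotate u) (rotate v) (rotate y) (rot u u·y≈0) (rot v v·y≈0)
    , component (rotate (rotate u)) (rotate (rotate v)) (rotate (rotate y))
        (trans (·-rotate (rotate u) (rotate y)) (rot u u·y≈0))
        (trans (·-rotate (rotate v) (rotate y)) (rot v v·y≈0))
    where
    rot : ∀ w → w · y ≈ 0# → rotate w · rotate y ≈ 0#
    rot w = trans (·-rotate w y)
    component : ∀ u v y → u · y ≈ 0# → v · y ≈ 0# → proj₁ ((u ⨯ v) ⨯ y) ≈ 0#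
    component u@(u₁ , u₂ , u₃) v@(v₁ , v₂ , v₃) y@(y₁ , y₂ , y₃) u·y≈0 v·y≈0 = begin
      proj₁ ((u ⨯ v) ⨯ y)
        ≈⟨ solve 9 (λ u₁ u₂ u₃ v₁ v₂ v₃ y₁ y₂ y₃ →
             (u₃ :* v₁ :- u₁ :* v₃) :* y₃ :- (u₁ :* v₂ :- u₂ :* v₁) :* y₂ :=
             v₁ :* (u₁ :* y₁ :+ u₂ :* y₂ :+ u₃ :* y₃) :- u₁ :* (v₁ :* y₁ :+ v₂ :* y₂ :+ v₃ :* y₃))
             refl u₁ u₂ u₃ v₁ v₂ v₃ y₁ y₂ y₃ ⟩
      v₁ * (u · y) - u₁ * (v · y)
        ≈⟨ +-cong (*-congˡ u·y≈0) (-‿cong (*-congˡ v·y≈0)) ⟩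
      v₁ * 0# - u₁ * 0#
        ≈⟨ solve 2 (λ v₁ u₁ → v₁ :* con (pos 0) :- u₁ :* con (pos 0) := con (pos 0)) refl v₁ u₁ ⟩
      0#  ∎

  -- In dimension 3 two planes cannot be orthogonal.
  orthogonal⇒multiple : ∀ u v y z → u ≉ᵥ 0ᵥ → y ≉ᵥ 0ᵥ →
    u · y ≈ 0# → v · y ≈ 0# → u · z ≈ 0# → v · z ≈ 0# →
    (∃[ c ] v ≈ᵥ c ⋆ u) ⊎ (∃[ c ] z ≈ᵥ c ⋆ y)
  orthogonal⇒multiple u v y z u≉0 y≉0 u·y≈0 v·y≈0 u·z≈0 v·z≈0 = decide ((u ⨯ v) ≟ᵥ 0ᵥ)
    where
    _≟ᵥ_ : Decidable _≈ᵥ_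
    (u₁ , u₂ , u₃) ≟ᵥ (v₁ , v₂ , v₃) = (u₁ ≟ v₁) ×-dec ((u₂ ≟ v₂) ×-dec (u₃ ≟ v₃))

    common-multiple : ∀ w → ∃[ t ] y ≈ᵥ t ⋆ w → ∃[ s ] z ≈ᵥ s ⋆ w → ∃[ c ] z ≈ᵥ c ⋆ y
    common-multiple w (t , y≈tw) (s , z≈sw) =
      -- The factor is s / t, where t is invertible because y = t w is nonzero.
      s * t⁻¹ , ≈ᵥ-trans z≈sw (≈ᵥ-trans (⋆-congʳ w s≈st⁻¹t)
        (≈ᵥ-trans (⋆-assoc (s * t⁻¹) t w) (⋆-congˡ (s * t⁻¹) (≈ᵥ-sym y≈tw))))
      where
      inverse : ∃[ t⁻¹ ] t * t⁻¹ ≈ 1#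
      inverse = invert t λ t≈0 → y≉0 (≈ᵥ-trans y≈tw (≈ᵥ-trans (⋆-congʳ w t≈0) (⋆-zero w)))
      t⁻¹ = proj₁ inverse
      s≈st⁻¹t : s ≈ s * t⁻¹ * t
      s≈st⁻¹t = begin
        s               ≈⟨ *-identityʳ s ⟨
        s * 1#          ≈⟨ *-congˡ (proj₂ inverse) ⟨
        s * (t * t⁻¹)   ≈⟨ solve 3 (λ s t t⁻¹ → s :* (t :* t⁻¹) := s :* t⁻¹ :* t) refl s t t⁻¹ ⟩
        s * t⁻¹ * t     ∎

    decide : Dec (u ⨯ v ≈ᵥ 0ᵥ) → (∃[ c ] v ≈ᵥ c ⋆ u) ⊎ (∃[ c ] z ≈ᵥ c ⋆ y)
    decide (yes u⨯v≈0) = inj₁ (⨯≈0⇒multiple u v u≉0 u⨯v≈0)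
    -- Both y and z are orthogonal to u and v, hence multiples of the nonzero vector u ⨯ v.
    decide (no u⨯v≉0)  = inj₂ (common-multiple (u ⨯ v)
      (⨯≈0⇒multiple (u ⨯ v) y u⨯v≉0 ([u⨯v]⨯y≈0 u v y u·y≈0 v·y≈0))
      (⨯≈0⇒multiple (u ⨯ v) z u⨯v≉0 ([u⨯v]⨯y≈0 u v z u·z≈0 v·z≈0)))

  -- The two-dimensional Lagrange identity for the last two coordinates, with u₂² + u₃² and a₂u₂ +
  -- a₃u₃ rewritten through u · u and a · u. When these two products vanish, only the term in a · a
  -- survives.
  lagrange-identity : ∀ a₁ a₂ a₃ u₁ u₂ u₃ →
    let a = a₁ , a₂ , a₃; u = u₁ , u₂ , u₃ in
    (a₂ * u₃ - a₃ * u₂) * (a₂ * u₃ - a₃ * u₂) ≈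
    - (a · a) * (u₁ * u₁) + ((a₂ * a₂ + a₃ * a₃) * (u · u) + ((1# + 1#) * (a₁ * u₁) - a · u) * (a · u))
  lagrange-identity = solve 6 (λ a₁ a₂ a₃ u₁ u₂ u₃ →
    let a·u = a₁ :* u₁ :+ a₂ :* u₂ :+ a₃ :* u₃ in
    (a₂ :* u₃ :- a₃ :* u₂) :* (a₂ :* u₃ :- a₃ :* u₂) :=
    :- (a₁ :* a₁ :+ a₂ :* a₂ :+ a₃ :* a₃) :* (u₁ :* u₁)
    :+ ((a₂ :* a₂ :+ a₃ :* a₃) :* (u₁ :* u₁ :+ u₂ :* u₂ :+ u₃ :* u₃)
        :+ (con (pos 2) :* (a₁ :* u₁) :- a·u) :* a·u))
    refl

  -- The root of - α is (a₂u₃ - a₃u₂) / u₁.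
  isotropic-pivot : ∀ {α} a u → proj₁ u ≉ 0# → a · a ≈ α → a · u ≈ 0# → u · u ≈ 0# →
    QuadraticResidue R (- α)
  isotropic-pivot {α} a@(a₁ , a₂ , a₃) u@(u₁ , u₂ , u₃) u₁≉0 a·a≈α a·u≈0 u·u≈0
    with u₁⁻¹ , u₁u₁⁻¹≈1 ← invert u₁ u₁≉0 = d * u₁⁻¹ , (begin
      d * u₁⁻¹ * (d * u₁⁻¹)
        ≈⟨ solve 2 (λ d i → d :* i :* (d :* i) := d :* d :* (i :* i)) refl d u₁⁻¹ ⟩
      d * d * (u₁⁻¹ * u₁⁻¹)
        ≈⟨ *-congʳ (lagrange-identity a₁ a₂ a₃ u₁ u₂ u₃) ⟩
      (- (a · a) * (u₁ * u₁) + (r * (u · u) + (r′ - a · u) * (a · u))) * (u₁⁻¹ * u₁⁻¹)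
        ≈⟨ *-congʳ (+-cong (*-congʳ (-‿cong a·a≈α)) (+-cong (*-congˡ u·u≈0) (*-congˡ a·u≈0))) ⟩
      (- α * (u₁ * u₁) + (r * 0# + (r′ - a · u) * 0#)) * (u₁⁻¹ * u₁⁻¹)
        ≈⟨ solve 5 (λ α u i x y →
             (:- α :* (u :* u) :+ (x :* con (pos 0) :+ y :* con (pos 0))) :* (i :* i) :=
             :- α :* (u :* i :* (u :* i)))
             refl α u₁ u₁⁻¹ r (r′ - a · u) ⟩
      - α * (u₁ * u₁⁻¹ * (u₁ * u₁⁻¹))
        ≈⟨ *-congˡ (*-cong u₁u₁⁻¹≈1 u₁u₁⁻¹≈1) ⟩
      - α * (1# * 1#)
        ≈⟨ solve 1 (λ α → :- α :* (con (pos 1) :* con (pos 1)) := :- α) refl α ⟩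
      - α  ∎)
    where
    d = a₂ * u₃ - a₃ * u₂
    r = a₂ * a₂ + a₃ * a₃
    r′ = (1# + 1#) * (a₁ * u₁)

  isotropic⇒-α∈QR : ∀ {α} a u → u ≉ᵥ 0ᵥ → a · a ≈ α → a · u ≈ 0# → u · u ≈ 0# →
    QuadraticResidue R (- α)
  isotropic⇒-α∈QR a u u≉0 a·a≈α a·u≈0 u·u≈0 =
    [ (λ u₁≉0 → isotropic-pivot a u u₁≉0 a·a≈α a·u≈0 u·u≈0)
    , [ (λ u₂≉0 → isotropic-pivot (rotate a) (rotate u) u₂≉0
          (trans (·-rotate a a) a·a≈α) (trans (·-rotate a u) a·u≈0) (trans (·-rotate u u) u·u≈0))
      , (λ u₃≉0 → isotropic-pivot (rotate (rotate a)) (rotate (rotate u)) u₃≉0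
          (trans (rotate² a a) a·a≈α) (trans (rotate² a u) a·u≈0) (trans (rotate² u u) u·u≈0))
      ]′
    ]′ (≉ᵥ0⇒component≉0 u u≉0)
    where
    rotate² : ∀ v w → rotate (rotate v) · rotate (rotate w) ≈ v · w
    rotate² v w = trans (·-rotate (rotate v) (rotate w)) (·-rotate v w)

  -- Collinear points and grids on the sphere.

  Q : Vector → Carrier
  Q v = v · v

  Q-+ : ∀ a u → Q (a +ᵥ u) ≈ Q a + (1# + 1#) * (a · u) + Q u
  Q-+ (a₁ , a₂ , a₃) (u₁ , u₂ , u₃) = solve 6 (λ a₁ a₂ a₃ u₁ u₂ u₃ →
    let sq x = x :* x in
    sq (a₁ :+ u₁) :+ sq (a₂ :+ u₂) :+ sq (a₃ :+ u₃) :=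
    sq a₁ :+ sq a₂ :+ sq a₃ :+ con (pos 2) :* (a₁ :* u₁ :+ a₂ :* u₂ :+ a₃ :* u₃)
    :+ (sq u₁ :+ sq u₂ :+ sq u₃))
    refl a₁ a₂ a₃ u₁ u₂ u₃

  ·-⋆ : ∀ c a u → a · (c ⋆ u) ≈ c * (a · u)
  ·-⋆ c (a₁ , a₂ , a₃) (u₁ , u₂ , u₃) = solve 7 (λ c a₁ a₂ a₃ u₁ u₂ u₃ →
    a₁ :* (c :* u₁) :+ a₂ :* (c :* u₂) :+ a₃ :* (c :* u₃) := c :* (a₁ :* u₁ :+ a₂ :* u₂ :+ a₃ :* u₃))
    refl c a₁ a₂ a₃ u₁ u₂ u₃

  Q-⋆ : ∀ c u → Q (c ⋆ u) ≈ c * c * Q u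
  Q-⋆ c (u₁ , u₂ , u₃) = solve 4 (λ c u₁ u₂ u₃ →
    let sq x = x :* x in
    sq (c :* u₁) :+ sq (c :* u₂) :+ sq (c :* u₃) := c :* c :* (sq u₁ :+ sq u₂ :+ sq u₃))
    refl c u₁ u₂ u₃

  module _ (2≉0 : 1# + 1# ≉ 0#) where

    -- Three collinear points on the sphere force the whole line into it.
    line∩sphere : ∀ {α} a u c → u ≉ᵥ 0ᵥ → c ≉ 0# → c ≉ 1# →
      Sphere R α a → Sphere R α (a +ᵥ u) → Sphere R α (a +ᵥ c ⋆ u) → QuadraticResidue R (- α)
    line∩sphere {α} a u c u≉0 c≉0 c≉1 a∈S a+u∈S a+cu∈S =
      isotropic⇒-α∈QR a u u≉0 a∈S a·u≈0 Qu≈0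
      where
      Qu≈0 : Q u ≈ 0#
      -- Since Q (a + c u) - Q a = 2c (a · u) + c² Q u, subtracting c times the case c = 1
      -- eliminates a · u and leaves c (c - 1) Q u.
      Qu≈0 = x*y≈0⇒y≈0 (c≉1 ∘ x-y≈0⇒x≈y c 1#) (x*y≈0⇒y≈0 c≉0 (begin
        c * ((c - 1#) * Q u)
          ≈⟨ solve 4 (λ A D U c →
               c :* ((c :- con (pos 1)) :* U) :=
               (A :+ con (pos 2) :* (c :* D) :+ c :* c :* U :- A)
               :- c :* (A :+ con (pos 2) :* D :+ U :- A))
               refl (Q a) (a · u) (Q u) c ⟩
        (Q a + (1# + 1#) * (c * (a · u)) + c * c * Q u - Q a) - c * (Q a + (1# + 1#) * (a · u) + Q u - Q a)
          ≈⟨ +-cong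
               (+-congʳ (trans (Q-+ a (c ⋆ u)) (+-cong (+-congˡ (*-congˡ (·-⋆ c a u))) (Q-⋆ c u))))
               (-‿cong (*-congˡ (+-congʳ (Q-+ a u)))) ⟨
        (Q (a +ᵥ c ⋆ u) - Q a) - c * (Q (a +ᵥ u) - Q a)
          ≈⟨ +-cong (+-cong a+cu∈S (-‿cong a∈S))
               (-‿cong (*-congˡ (+-cong a+u∈S (-‿cong a∈S)))) ⟩
        (α - α) - c * (α - α)
          ≈⟨ solve 2 (λ α c → (α :- α) :- c :* (α :- α) := con (pos 0)) refl α c ⟩
        0#  ∎))

      a·u≈0 : a · u ≈ 0#
      -- With Q u = 0 known, Q (a + u) = Q a reduces to 2 (a · u) = 0.
      a·u≈0 = x*y≈0⇒y≈0 2≉0 (begin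
        (1# + 1#) * (a · u)
          ≈⟨ solve 3 (λ A D U → D := (A :+ D :+ U :- A) :- U) refl (Q a) ((1# + 1#) * (a · u)) (Q u) ⟩
        (Q a + (1# + 1#) * (a · u) + Q u - Q a) - Q u
          ≈⟨ +-congʳ (+-congʳ (Q-+ a u)) ⟨
        (Q (a +ᵥ u) - Q a) - Q u
          ≈⟨ +-cong (+-cong a+u∈S (-‿cong a∈S)) (-‿cong Qu≈0) ⟩
        (α - α) - 0#
          ≈⟨ solve 1 (λ α → (α :- α) :- con (pos 0) := con (pos 0)) refl α ⟩
        0#  ∎)

    -- Polarisation: twice the inner product is the alternating sum of `Q` over the four points, and
    -- all four values are α.
    differences-orthogonal : ∀ {α} x x′ k k′ →
      Sphere R α (x +ᵥ k) → Sphere R α (x′ +ᵥ k) → Sphere R α (x +ᵥ k′) → Sphere R α (x′ +ᵥ k′) →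
      (x′ -ᵥ x) · (k′ -ᵥ k) ≈ 0#
    differences-orthogonal {α} x@(x₁ , x₂ , x₃) x′@(x₁′ , x₂′ , x₃′) k@(k₁ , k₂ , k₃) k′@(k₁′ , k₂′ , k₃′)
      xk x′k xk′ x′k′ = x*y≈0⇒y≈0 2≉0 (begin
        (1# + 1#) * ((x′ -ᵥ x) · (k′ -ᵥ k))
          ≈⟨ trans (*-congˡ (+-assoc _ _ _)) (trans (distribˡ _ _ _) (+-cong
               (component x₁ x₁′ k₁ k₁′) (trans (distribˡ _ _ _) (+-cong
               (component x₂ x₂′ k₂ k₂′) (component x₃ x₃′ k₃ k₃′))))) ⟩
        -- The expansion was made coordinate by coordinate; the squares are now regrouped point by
        -- point.
        _ ≈⟨ solve 12 (λ a₁ b₁ c₁ d₁ a₂ b₂ c₂ d₂ a₃ b₃ c₃ d₃ →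
               ((a₁ :- b₁) :- (c₁ :- d₁)) :+ (((a₂ :- b₂) :- (c₂ :- d₂)) :+ ((a₃ :- b₃) :- (c₃ :- d₃))) :=
               ((a₁ :+ a₂ :+ a₃) :- (b₁ :+ b₂ :+ b₃)) :- ((c₁ :+ c₂ :+ c₃) :- (d₁ :+ d₂ :+ d₃)))
               refl _ _ _ _ _ _ _ _ _ _ _ _ ⟩
        (Q (x +ᵥ k) - Q (x′ +ᵥ k)) - (Q (x +ᵥ k′) - Q (x′ +ᵥ k′))
          ≈⟨ +-cong (+-cong xk (-‿cong x′k)) (-‿cong (+-cong xk′ (-‿cong x′k′))) ⟩
        (α - α) - (α - α)
          ≈⟨ solve 1 (λ α → (α :- α) :- (α :- α) := con (pos 0)) refl α ⟩
        0#  ∎)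
      where
      component : ∀ x x′ k k′ → (1# + 1#) * ((x′ - x) * (k′ - k)) ≈
        ((x + k) * (x + k) - (x′ + k) * (x′ + k)) - ((x + k′) * (x + k′) - (x′ + k′) * (x′ + k′))
      component = solve 4 (λ x x′ k k′ →
        let sq x = x :* x in
        con (pos 2) :* ((x′ :- x) :* (k′ :- k)) :=
        (sq (x :+ k) :- sq (x′ :+ k)) :- (sq (x :+ k′) :- sq (x′ :+ k′)))
        refl

    -- The points are a, a + u and a + c u with a = x 0 + k. Injectivity gives u ≠ 0, c ≠ 0 and c ≠
    -- 1 by comparing x 1 with x 0, x 2 with x 0 and x 2 with x 1.
    collinear-triple : ∀ {α} (x : Fin 3 → Vector) → Injective _≡_ _≈ᵥ_ x → ∀ k →
      (∀ i → Sphere R α (x i +ᵥ k)) → (∃[ c ] x 2F -ᵥ x 0F ≈ᵥ c ⋆ (x 1F -ᵥ x 0F)) →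
      QuadraticResidue R (- α)
    collinear-triple x x-inj k x+k∈S (c , v≈cu) =
      line∩sphere (x 0F +ᵥ k) u c
        (λ u≈0 → contradiction (x-inj (x-y≈0⇒x≈ᵥy (x 1F) (x 0F) u≈0)) λ ())
        (λ c≈0 → contradiction (x-inj (x-y≈0⇒x≈ᵥy (x 2F) (x 0F)
          (≈ᵥ-trans v≈cu (≈ᵥ-trans (⋆-congʳ u c≈0) (⋆-zero u))))) λ ())
        (λ c≈1 → contradiction (x-inj (-ᵥ-cancelʳ (x 2F) (x 1F) (x 0F)
          (≈ᵥ-trans v≈cu (≈ᵥ-trans (⋆-congʳ u c≈1) (⋆-identity u))))) λ ())
        (x+k∈S 0F)
        (Sphere-resp (shift (x 0F) (x 1F)) (x+k∈S 1F))
        (Sphere-resp (≈ᵥ-trans (shift (x 0F) (x 2F)) (+ᵥ-congˡ (x 0F +ᵥ k) v≈cu)) (x+k∈S 2F))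
      where
      u = x 1F -ᵥ x 0F
      component : ∀ y y′ k → y′ + k ≈ y + k + (y′ - y)
      component = solve 3 (λ y y′ k → y′ :+ k := y :+ k :+ (y′ :- y)) refl
      shift : ∀ y y′ → y′ +ᵥ k ≈ᵥ y +ᵥ k +ᵥ (y′ -ᵥ y)
      shift _ _ = component _ _ _ , component _ _ _ , component _ _ _

    grid⊆sphere : ∀ {α} (x k : Fin 3 → Vector) → Injective _≡_ _≈ᵥ_ x → Injective _≡_ _≈ᵥ_ k →
      (∀ i j → Sphere R α (x i +ᵥ k j)) → QuadraticResidue R (- α)
    grid⊆sphere {α} x k x-inj k-inj x+k∈S =
      [ collinear-triple x x-inj (k 0F) (λ i → x+k∈S i 0F)
      -- Commutativity of addition exchanges the roles of the two triples.
      , collinear-triple k k-inj (x 0F) (λ j → Sphere-resp (+ᵥ-comm (x 0F) (k j)) (x+k∈S 0F j))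
      ]′ (orthogonal⇒multiple _ _ _ _ (distinct x x-inj) (distinct k k-inj)
            (orthogonal 1F 1F) (orthogonal 2F 1F) (orthogonal 1F 2F) (orthogonal 2F 2F))
      where
      distinct : ∀ x → Injective _≡_ _≈ᵥ_ x → x 1F -ᵥ x 0F ≉ᵥ 0ᵥ
      distinct x x-inj e = contradiction (x-inj (x-y≈0⇒x≈ᵥy (x 1F) (x 0F) e)) λ ()
      orthogonal : ∀ i j → (x i -ᵥ x 0F) · (k j -ᵥ k 0F) ≈ 0#
      orthogonal i j = differences-orthogonal (x 0F) (x i) (k 0F) (k j)
        (x+k∈S 0F 0F) (x+k∈S i 0F) (x+k∈S 0F j) (x+k∈S i j)

    -- Membership in the sphere is decidable, so a finite search turns the impossibility of a full
    -- grid into an explicit translate that fails.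
    sphere-isC₃[3] : ∀ {α} → ¬ QuadraticResidue R (- α) → IsC[_,_]-Set (Cube R) 3 3 (Sphere R α)
    sphere-isC₃[3] {α} -α∉QR X (x , x-inj , X⇔x) k k-inj =
      let j , ¬x+kⱼ∈S = ¬∀⟶∃¬ 3 _ (λ j → all? λ i → ((x i +ᵥ k j) · (x i +ᵥ k j)) ≟ α)
                          (λ x+k∈S → -α∉QR (grid⊆sphere x k x-inj k-inj (λ i j → x+k∈S j i)))
      in j , λ X+kⱼ⊆S → ¬x+kⱼ∈S λ i →
           X+kⱼ⊆S (x i , Equivalence.from (X⇔x (x i)) (i , ≈ᵥ-refl) , ≈ᵥ-refl)

    -- The vectors (a , b , ±1) are isotropic and (b , - a , 0) is orthogonal to both.  In the
    -- resulting coordinates s, y, z the sphere is the surface y z = α + s², whose right-hand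
    -- side never vanishes, so that (s , y) with y ≉ 0 parametrise it.
    module Parametrisation (a b α : Carrier) (a²+b²≈-1 : a * a + b * b ≈ - 1#)
      (-α∉QR : ¬ QuadraticResidue R (- α)) where

      ½ : Carrier
      ½ = proj₁ (invert (1# + 1#) 2≉0)

      2*½≈1 : (1# + 1#) * ½ ≈ 1#
      2*½≈1 = proj₂ (invert (1# + 1#) 2≉0)

      -- This is (z / 2) (a , b , 1) - (y / 2) (a , b , - 1) + s (b , - a , 0).
      point : Carrier → Carrier → Carrier → Vector
      point s y z = a * w + b * s , b * w - a * s , (y + z) * ½
        where w = (z - y) * ½

      -- Up to sign, the inner products with (b , - a , 0), (a , b , 1) and (a , b , - 1). As the
      -- last two are isotropic, pairing with one of them extracts the coefficient of the other.
      s-coord y-coord z-coord : Vector → Carrier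
      s-coord (x₁ , x₂ , x₃) = a * x₂ - b * x₁
      y-coord (x₁ , x₂ , x₃) = x₃ + (a * x₁ + b * x₂)
      z-coord (x₁ , x₂ , x₃) = x₃ - (a * x₁ + b * x₂)

      *-norm : ∀ x → (a * a + b * b) * x ≈ - x
      *-norm x = trans (*-congʳ a²+b²≈-1) (solve 1 (λ x → :- con (pos 1) :* x := :- x) refl x)

      *-2½ : ∀ x → (1# + 1#) * ½ * x ≈ x
      *-2½ x = trans (*-congʳ 2*½≈1) (*-identityˡ x)

      -- By a² + b² = - 1 the first two squares add up to - (w² + s²), and ((y + z) / 2)² - w² = y
      -- z.
      point∈sphere : ∀ {s y z} → y * z ≈ α + s * s → Sphere R α (point s y z)
      point∈sphere {s} {y} {z} yz≈α+s² = begin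
        (a * w + b * s) * (a * w + b * s) + (b * w - a * s) * (b * w - a * s) + x₃ * x₃
          ≈⟨ solve 5 (λ a b w s x₃ →
               (a :* w :+ b :* s) :* (a :* w :+ b :* s) :+ (b :* w :- a :* s) :* (b :* w :- a :* s) :+ x₃ :* x₃ :=
               (a :* a :+ b :* b) :* (w :* w :+ s :* s) :+ x₃ :* x₃) refl a b w s x₃ ⟩
        (a * a + b * b) * (w * w + s * s) + x₃ * x₃
          ≈⟨ +-congʳ (*-norm (w * w + s * s)) ⟩
        - (w * w + s * s) + x₃ * x₃
          ≈⟨ solve 4 (λ s y z h →
               :- ((z :- y) :* h :* ((z :- y) :* h) :+ s :* s) :+ (y :+ z) :* h :* ((y :+ z) :* h) :=
               con (pos 2) :* h :* (con (pos 2) :* h :* (y :* z)) :- s :* s) refl s y z ½ ⟩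
        (1# + 1#) * ½ * ((1# + 1#) * ½ * (y * z)) - s * s
          ≈⟨ +-congʳ (trans (*-2½ _) (*-2½ (y * z))) ⟩
        y * z - s * s
          ≈⟨ +-congʳ yz≈α+s² ⟩
        α + s * s - s * s
          ≈⟨ solve 2 (λ α s → α :+ s :* s :- s :* s := α) refl α s ⟩
        α  ∎
        where
        w = (z - y) * ½
        x₃ = (y + z) * ½

      s-coord-point : ∀ s y z → s-coord (point s y z) ≈ s
      s-coord-point s y z = begin
        a * (b * w - a * s) - b * (a * w + b * s)
          ≈⟨ solve 4 (λ a b w s → a :* (b :* w :- a :* s) :- b :* (a :* w :+ b :* s) :=
               :- ((a :* a :+ b :* b) :* s)) refl a b w s ⟩
        - ((a * a + b * b) * s)  ≈⟨ -‿cong (*-norm s) ⟩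
        - - s                    ≈⟨ solve 1 (λ s → :- (:- s) := s) refl s ⟩
        s                        ∎
        where w = (z - y) * ½

      y-coord-point : ∀ s y z → y-coord (point s y z) ≈ y
      y-coord-point s y z = begin
        (y + z) * ½ + (a * (a * w + b * s) + b * (b * w - a * s))
          ≈⟨ +-congˡ (solve 4 (λ a b w s → a :* (a :* w :+ b :* s) :+ b :* (b :* w :- a :* s) :=
               (a :* a :+ b :* b) :* w) refl a b w s) ⟩
        (y + z) * ½ + (a * a + b * b) * w
          ≈⟨ +-congˡ (*-norm w) ⟩
        (y + z) * ½ - (z - y) * ½
          ≈⟨ solve 3 (λ y z h → (y :+ z) :* h :- (z :- y) :* h := con (pos 2) :* h :* y) refl y z ½ ⟩
        (1# + 1#) * ½ * y
          ≈⟨ *-2½ y ⟩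
        y  ∎
        where w = (z - y) * ½

      point-coord : ∀ x → point (s-coord x) (y-coord x) (z-coord x) ≈ᵥ x
      point-coord (x₁ , x₂ , x₃) = first , second , third
        where
        t = a * x₁ + b * x₂
        w = ((x₃ - t) - (x₃ + t)) * ½

        w≈-t : w ≈ - t
        w≈-t = trans (solve 3 (λ x₃ t h → ((x₃ :- t) :- (x₃ :+ t)) :* h := con (pos 2) :* h :* :- t) refl x₃ t ½)
                     (*-2½ (- t))

        norm⁻ : ∀ x → - ((a * a + b * b) * x) ≈ x
        norm⁻ x = trans (-‿cong (*-norm x)) (solve 1 (λ x → :- (:- x) := x) refl x)

        first : a * w + b * (a * x₂ - b * x₁) ≈ x₁
        first = begin
          a * w + b * (a * x₂ - b * x₁)    ≈⟨ +-congʳ (*-congˡ w≈-t) ⟩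
          a * - t + b * (a * x₂ - b * x₁)
            ≈⟨ solve 4 (λ a b x₁ x₂ → a :* :- (a :* x₁ :+ b :* x₂) :+ b :* (a :* x₂ :- b :* x₁) :=
                 :- ((a :* a :+ b :* b) :* x₁)) refl a b x₁ x₂ ⟩
          - ((a * a + b * b) * x₁)         ≈⟨ norm⁻ x₁ ⟩
          x₁                               ∎

        second : b * w - a * (a * x₂ - b * x₁) ≈ x₂
        second = begin
          b * w - a * (a * x₂ - b * x₁)    ≈⟨ +-congʳ (*-congˡ w≈-t) ⟩
          b * - t - a * (a * x₂ - b * x₁)
            ≈⟨ solve 4 (λ a b x₁ x₂ → b :* :- (a :* x₁ :+ b :* x₂) :- a :* (a :* x₂ :- b :* x₁) :=
                 :- ((a :* a :+ b :* b) :* x₂)) refl a b x₁ x₂ ⟩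
          - ((a * a + b * b) * x₂)         ≈⟨ norm⁻ x₂ ⟩
          x₂                               ∎

        third : ((x₃ + t) + (x₃ - t)) * ½ ≈ x₃
        third = trans (solve 3 (λ x₃ t h → ((x₃ :+ t) :+ (x₃ :- t)) :* h := con (pos 2) :* h :* x₃) refl x₃ t ½)
                      (*-2½ x₃)

      -- The product is x₃² - (a x₁ + b x₂)², and the two-dimensional Lagrange identity gives (a x₁
      -- + b x₂)² + s² = (a² + b²)(x₁² + x₂²) = - (x₁² + x₂²).
      y*z≈α+s² : ∀ {x} → Sphere R α x → y-coord x * z-coord x ≈ α + s-coord x * s-coord x
      y*z≈α+s² {x₁ , x₂ , x₃} x∈S = begin
        (x₃ + (a * x₁ + b * x₂)) * (x₃ - (a * x₁ + b * x₂))
          ≈⟨ solve 5 (λ a b x₁ x₂ x₃ →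
               (x₃ :+ (a :* x₁ :+ b :* x₂)) :* (x₃ :- (a :* x₁ :+ b :* x₂)) :=
               x₃ :* x₃ :- (a :* a :+ b :* b) :* (x₁ :* x₁ :+ x₂ :* x₂)
               :+ (a :* x₂ :- b :* x₁) :* (a :* x₂ :- b :* x₁)) refl a b x₁ x₂ x₃ ⟩
        x₃ * x₃ - (a * a + b * b) * (x₁ * x₁ + x₂ * x₂) + s * s
          ≈⟨ +-congʳ (+-congˡ (-‿cong (*-norm _))) ⟩
        x₃ * x₃ - - (x₁ * x₁ + x₂ * x₂) + s * s
          ≈⟨ +-congʳ (solve 2 (λ u v → u :- :- v := v :+ u) refl (x₃ * x₃) (x₁ * x₁ + x₂ * x₂)) ⟩
        x₁ * x₁ + x₂ * x₂ + x₃ * x₃ + s * s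
          ≈⟨ +-congʳ x∈S ⟩
        α + s * s  ∎
        where s = a * x₂ - b * x₁

      -- A zero would make s a root of - α.
      α+s²≉0 : ∀ s → α + s * s ≉ 0#
      α+s²≉0 s α+s²≈0 = -α∉QR (s , (begin
        s * s              ≈⟨ solve 2 (λ α s → s :* s := α :+ s :* s :- α) refl α s ⟩
        α + s * s - α      ≈⟨ +-congʳ α+s²≈0 ⟩
        0# - α             ≈⟨ +-identityˡ (- α) ⟩
        - α                ∎))

      y-coord≉0 : ∀ x → Sphere R α x → y-coord x ≉ 0#
      y-coord≉0 x x∈S y≈0 = α+s²≉0 (s-coord x) (begin
        α + s-coord x * s-coord x  ≈⟨ y*z≈α+s² x∈S ⟨
        y-coord x * z-coord x      ≈⟨ *-congʳ y≈0 ⟩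
        0# * z-coord x             ≈⟨ zeroˡ (z-coord x) ⟩
        0#                         ∎)

      sphere-point : Carrier → ∀ y → y ≉ 0# → Vector
      sphere-point s y y≉0 = point s y (proj₁ (invert y y≉0) * (α + s * s))

      y*y⁻¹*x≈x : ∀ y y≉0 x → y * (proj₁ (invert y y≉0) * x) ≈ x
      y*y⁻¹*x≈x y y≉0 x = trans (sym (*-assoc _ _ _)) (trans (*-congʳ (proj₂ (invert y y≉0))) (*-identityˡ x))

      sphere-point∈sphere : ∀ s y y≉0 → Sphere R α (sphere-point s y y≉0)
      sphere-point∈sphere s y y≉0 = point∈sphere (y*y⁻¹*x≈x y y≉0 (α + s * s))

      s-coord-sphere-point : ∀ s y y≉0 → s-coord (sphere-point s y y≉0) ≈ s
      s-coord-sphere-point s y _ = s-coord-point s y _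

      y-coord-sphere-point : ∀ s y y≉0 → y-coord (sphere-point s y y≉0) ≈ y
      y-coord-sphere-point s y _ = y-coord-point s y _

      point-cong : ∀ {s s′ y y′ z z′} → s ≈ s′ → y ≈ y′ → z ≈ z′ → point s y z ≈ᵥ point s′ y′ z′
      point-cong s≈ y≈ z≈ =
          +-cong (*-congˡ w≈) (*-congˡ s≈)
        , +-cong (*-congˡ w≈) (-‿cong (*-congˡ s≈))
        , *-congʳ (+-cong y≈ z≈)
        where w≈ = *-congʳ (+-cong z≈ (-‿cong y≈))

      -- The arguments s and y need only equal the coordinates of x, and the proof of y ≠ 0 is
      -- arbitrary, so that the enumeration may present y in its own form.
      sphere-point-coord : ∀ x → Sphere R α x → ∀ {s y} → s ≈ s-coord x → y ≈ y-coord x → ∀ y≉0 →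
        sphere-point s y y≉0 ≈ᵥ x
      sphere-point-coord x x∈S {s} {y} s≈ y≈ y≉0 =
        ≈ᵥ-trans (point-cong s≈ y≈ (begin
          y⁻¹ * (α + s * s)                    ≈⟨ *-congˡ (+-congˡ (*-cong s≈ s≈)) ⟩
          y⁻¹ * (α + s-coord x * s-coord x)    ≈⟨ *-congˡ (y*z≈α+s² x∈S) ⟨
          y⁻¹ * (y-coord x * z-coord x)        ≈⟨ *-congˡ (*-congʳ y≈) ⟨
          y⁻¹ * (y * z-coord x)                ≈⟨ solve 3 (λ i y z → i :* (y :* z) := y :* (i :* z)) refl y⁻¹ y (z-coord x) ⟩
          y * (y⁻¹ * z-coord x)                ≈⟨ y*y⁻¹*x≈x y y≉0 (z-coord x) ⟩
          z-coord x                            ∎)) (point-coord x)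
        where y⁻¹ = proj₁ (invert y y≉0)

open ≡ using (refl; sym; trans; cong; cong₂; subst)
open Algebra.Properties.CommutativeMonoid.Sum ℕ.+-0-commutativeMonoid
  using (sum; sum-cong-≗; sum-remove; sum-replicate-zero; ∑-distrib-+; sum-permute)

-- Counting in finite sets and the parity of fixed points.

indicator : ∀ {a} {A : Set a} → Dec A → ℕ
indicator (yes _) = 1
indicator (no  _) = 0

indicator-true : ∀ {a} {A : Set a} (A? : Dec A) → A → indicator A? ≡ 1
indicator-true (yes _) _ = refl
indicator-true (no ¬a) a = contradiction a ¬a

indicator-false : ∀ {a} {A : Set a} (A? : Dec A) → ¬ A → indicator A? ≡ 0
indicator-false (yes a) ¬a = contradiction a ¬a
indicator-false (no _)  _  = refl

sum-ones : ∀ n → sum {n} (λ _ → 1) ≡ n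
sum-ones zero    = refl
sum-ones (suc n) = cong suc (sum-ones n)

count : ∀ {n p} {P : Fin n → Set p} → Unary.Decidable P → ℕ
count P? = sum (λ i → indicator (P? i))

count-none : ∀ {n p} {P : Fin n → Set p} (P? : Unary.Decidable P) → (∀ i → ¬ P i) → count P? ≡ 0
count-none {n} P? none =
  trans (sum-cong-≗ (λ i → indicator-false (P? i) (none i))) (sum-replicate-zero n)

count-remove : ∀ {n p} {P : Fin (suc n) → Set p} (P? : Unary.Decidable P) a → P a →
  count P? ≡ suc (count (P? ∘ punchIn a))
count-remove P? a Pa =
  trans (sum-remove (λ i → indicator (P? i))) (cong (ℕ._+ count (P? ∘ punchIn a)) (indicator-true (P? a) Pa))

count-one : ∀ {n p} {P : Fin n → Set p} (P? : Unary.Decidable P) a → P a → (∀ i → P i → i ≡ a) →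
  count P? ≡ 1
count-one {suc n} P? a Pa unique = trans (count-remove P? a Pa)
  (cong suc (count-none (P? ∘ punchIn a) λ i Pi → punchInᵢ≢i a i (unique (punchIn a i) Pi)))

count-two : ∀ {n p} {P : Fin n → Set p} (P? : Unary.Decidable P) a b → a ≢ b → P a → P b →
  (∀ i → P i → i ≡ a ⊎ i ≡ b) → count P? ≡ 2
count-two {suc n} {P = P} P? a b a≢b Pa Pb only = trans (count-remove P? a Pa)
  (cong suc (count-one (P? ∘ punchIn a) (punchOut a≢b)
    (subst P (sym (punchIn-punchOut a≢b)) Pb)
    λ i Pi → [ (λ eq → contradiction eq (punchInᵢ≢i a i))
             , (λ eq → punchIn-injective a i _ (trans eq (sym (punchIn-punchOut a≢b))))
             ]′ (only (punchIn a i) Pi)))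

-- An involution matches the points with i < f i bijectively with those with f i < i; k is the size
-- of either class.
involution-parity : ∀ {n} (f : Fin n → Fin n) → (∀ i → f (f i) ≡ i) →
  ∃[ k ] n ≡ k ℕ.+ k ℕ.+ count (λ i → f i ≟ i)
involution-parity {n} f f-inv = count up? , (begin
  n
    ≡⟨ sum-ones n ⟨
  sum {n} (λ _ → 1)
    ≡⟨ sum-cong-≗ trichotomy ⟨
  sum (λ i → indicator (up? i) ℕ.+ indicator (down? i) ℕ.+ indicator (f i ≟ i))
    ≡⟨ ∑-distrib-+ (λ i → indicator (up? i) ℕ.+ indicator (down? i)) (λ i → indicator (f i ≟ i)) ⟩
  sum (λ i → indicator (up? i) ℕ.+ indicator (down? i)) ℕ.+ count (λ i → f i ≟ i)
    ≡⟨ cong (ℕ._+ count (λ i → f i ≟ i)) (∑-distrib-+ (λ i → indicator (up? i)) (λ i → indicator (down? i))) ⟩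
  count up? ℕ.+ count down? ℕ.+ count (λ i → f i ≟ i)
    ≡⟨ cong (λ k → count up? ℕ.+ k ℕ.+ count (λ i → f i ≟ i)) up≡down ⟨
  count up? ℕ.+ count up? ℕ.+ count (λ i → f i ≟ i)  ∎)
  where
  open ≡-Reasoning
  up? : Unary.Decidable (λ i → i Fin.< f i)
  up? i = i <? f i
  down? : Unary.Decidable (λ i → f i Fin.< i)
  down? i = f i <? i

  up≡down : count up? ≡ count down?
  -- Reindexing along f itself exchanges the two conditions.
  up≡down = trans (sum-permute (λ i → indicator (up? i)) (permutation f f f-inv f-inv))
    (sum-cong-≗ λ i → cong (λ j → indicator (f i <? j)) (f-inv i))

  trichotomy : ∀ i → indicator (up? i) ℕ.+ indicator (down? i) ℕ.+ indicator (f i ≟ i) ≡ 1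
  trichotomy i with <-cmp i (f i)
  ... | tri< a b c = cong₂ ℕ._+_ (cong₂ ℕ._+_ (indicator-true (up? i) a) (indicator-false (down? i) c))
                                 (indicator-false (f i ≟ i) (b ∘ sym))
  ... | tri≈ a b c = cong₂ ℕ._+_ (cong₂ ℕ._+_ (indicator-false (up? i) a) (indicator-false (down? i) c))
                                 (indicator-true (f i ≟ i) (sym b))
  ... | tri> a b c = cong₂ ℕ._+_ (cong₂ ℕ._+_ (indicator-false (up? i) a) (indicator-true (down? i) c))
                                 (indicator-false (f i ≟ i) (b ∘ sym))

-- Odd numbers and their residues modulo 4.

odd⇒1+2m : ∀ p → 2 ∤ p → ∃[ m ] p ≡ suc (m ℕ.+ m)
odd⇒1+2m p 2∤p = p / 2 , (begin
  p                          ≡⟨ m≡m%n+[m/n]*n p 2 ⟩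
  p % 2 ℕ.+ p / 2 ℕ.* 2      ≡⟨ cong₂ ℕ._+_ (remainder (p % 2) (m%n<n p 2) (2∤p ∘ m%n≡0⇒n∣m p 2)) (double (p / 2)) ⟩
  1 ℕ.+ (p / 2 ℕ.+ p / 2)    ∎)
  where
  open ≡-Reasoning
  remainder : ∀ r → r < 2 → r ≢ 0 → r ≡ 1
  remainder 0 _ r≢0 = contradiction refl r≢0
  remainder 1 _ _   = refl
  remainder (suc (suc _)) (s≤s (s≤s ())) _
  double : ∀ k → k ℕ.* 2 ≡ k ℕ.+ k
  double = solve 1 (λ k → k :* con 2 := k :+ k) refl
    where open +-*-Solver

-- The residue of p = 1 + 2m when m - 2k = 2 is the number of fixed points of inversion.
[1+2[2k+2]]%4≡1 : ∀ k → suc (k ℕ.+ k ℕ.+ 2 ℕ.+ (k ℕ.+ k ℕ.+ 2)) % 4 ≡ 1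
[1+2[2k+2]]%4≡1 k = trans (cong (_% 4) (rearranged k)) ([m+kn]%n≡m%n 1 (k ℕ.+ 1) 4)
  where
  open +-*-Solver
  rearranged : ∀ k → suc (k ℕ.+ k ℕ.+ 2 ℕ.+ (k ℕ.+ k ℕ.+ 2)) ≡ 1 ℕ.+ (k ℕ.+ 1) ℕ.* 4
  rearranged = solve 1 (λ k →
    con 1 :+ (k :+ k :+ con 2 :+ (k :+ k :+ con 2)) := con 1 :+ (k :+ con 1) :* con 4) refl

-- The same for a single fixed point, m = 2k + 1.
[1+2[2k+1]]%4≡3 : ∀ k → suc (k ℕ.+ k ℕ.+ 1 ℕ.+ (k ℕ.+ k ℕ.+ 1)) % 4 ≡ 3
[1+2[2k+1]]%4≡3 k = trans (cong (_% 4) (rearranged k)) ([m+kn]%n≡m%n 3 k 4)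
  where
  open +-*-Solver
  rearranged : ∀ k → suc (k ℕ.+ k ℕ.+ 1 ℕ.+ (k ℕ.+ k ℕ.+ 1)) ≡ 3 ℕ.+ k ℕ.* 4
  rearranged = solve 1 (λ k →
    con 1 :+ (k :+ k :+ con 1 :+ (k :+ k :+ con 1)) := con 3 :+ k :* con 4) refl

-- The field with p = 2m + 1 elements.

module OddPrime (m : ℕ) (p-prime : Prime (suc (m ℕ.+ m))) where

  p : ℕ
  p = suc (m ℕ.+ m)

  open CommutativeRing (ℤ/ p)
    using (Carrier; _+_; _*_; _-_; -_; 0#; 1#; zeroˡ; zeroʳ; *-identityˡ; *-identityʳ; -‿inverseʳ; +-identityʳ; *-comm)
  open IntegerCoefficients (ℤ/ p) using (solve; _:=_; _:+_; _:*_; _:-_; :-_; con)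
  open ≡-Reasoning

  ι : ℕ → Carrier
  ι n = n mod p

  toℕ-ι : ∀ n → toℕ (ι n) ≡ n % p
  toℕ-ι n = toℕ-fromℕ< (m%n<n n p)

  ι-toℕ : ∀ x → ι (toℕ x) ≡ x
  ι-toℕ x = toℕ-injective (trans (toℕ-ι (toℕ x)) (m<n⇒m%n≡m (toℕ<n x)))

  ι-+ : ∀ a b → ι (a ℕ.+ b) ≡ ι a + ι b
  ι-+ a b = toℕ-injective (begin
    toℕ (ι (a ℕ.+ b))                ≡⟨ toℕ-ι (a ℕ.+ b) ⟩
    (a ℕ.+ b) % p                    ≡⟨ %-distribˡ-+ a b p ⟩
    (a % p ℕ.+ b % p) % p            ≡⟨ cong₂ (λ x y → (x ℕ.+ y) % p) (toℕ-ι a) (toℕ-ι b) ⟨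
    (toℕ (ι a) ℕ.+ toℕ (ι b)) % p    ≡⟨ toℕ-ι (toℕ (ι a) ℕ.+ toℕ (ι b)) ⟨
    toℕ (ι a + ι b)                  ∎)

  ι-* : ∀ a b → ι (a ℕ.* b) ≡ ι a * ι b
  ι-* a b = toℕ-injective (begin
    toℕ (ι (a ℕ.* b))                ≡⟨ toℕ-ι (a ℕ.* b) ⟩
    (a ℕ.* b) % p                    ≡⟨ %-distribˡ-* a b p ⟩
    ((a % p) ℕ.* (b % p)) % p        ≡⟨ cong₂ (λ x y → (x ℕ.* y) % p) (toℕ-ι a) (toℕ-ι b) ⟨
    (toℕ (ι a) ℕ.* toℕ (ι b)) % p    ≡⟨ toℕ-ι (toℕ (ι a) ℕ.* toℕ (ι b)) ⟨
    toℕ (ι a * ι b)                  ∎)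

  ι-injective : ∀ {a b} → a < p → b < p → ι a ≡ ι b → a ≡ b
  ι-injective {a} {b} a<p b<p eq = begin
    a          ≡⟨ m<n⇒m%n≡m a<p ⟨
    a % p      ≡⟨ toℕ-ι a ⟨
    toℕ (ι a)  ≡⟨ cong toℕ eq ⟩
    toℕ (ι b)  ≡⟨ toℕ-ι b ⟩
    b % p      ≡⟨ m<n⇒m%n≡m b<p ⟩
    b          ∎

  ι[k*p]≡0 : ∀ k → ι (k ℕ.* p) ≡ 0#
  ι[k*p]≡0 k = toℕ-injective (trans (toℕ-ι (k ℕ.* p)) (m*n%n≡0 k p))

  1<p : 1 < p
  1<p = ℕ.nonTrivial⇒n>1 p {{prime⇒nonTrivial p-prime}}

  2<p : 2 < p
  2<p = go m 1<p
    where
    go : ∀ m → 1 < suc (m ℕ.+ m) → 2 < suc (m ℕ.+ m)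
    go zero    (s≤s ())
    go (suc m) _ = s≤s (s≤s (subst (1 ≤_) (sym (ℕ.+-suc m m)) (s≤s z≤n)))

  1≢0 : 1# ≢ 0#
  1≢0 1≡0 = contradiction (ι-injective {1} {0} 1<p ℕ.z<s 1≡0) λ ()

  2≢0 : 1# + 1# ≢ 0#
  2≢0 2≡0 = contradiction (ι-injective {2} {0} 2<p ℕ.z<s (trans (ι-+ 1 1) 2≡0)) λ ()

  -- Bézout's identity for p and x is read modulo p. Over the naturals it has two forms, 1 + k p = l
  -- x and 1 + l x = k p, whence the inverses l and - l.
  invert : NonzeroInvertible (ℤ/ p)
  invert x x≢0 = bézout (coprime-Bézout (prime⇒coprime p-prime {{ℕ.≢-nonZero toℕx≢0}} (toℕ<n x)))
    where
    toℕx≢0 : toℕ x ≢ 0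
    toℕx≢0 eq = x≢0 (trans (sym (ι-toℕ x)) (cong ι eq))

    ι[k*x] : ∀ k → ι (k ℕ.* toℕ x) ≡ ι k * x
    ι[k*x] k = trans (ι-* k (toℕ x)) (cong (ι k *_) (ι-toℕ x))

    bézout : Bézout.Identity 1 p (toℕ x) → ∃[ y ] x * y ≡ 1#
    bézout (Bézout.-+ k l eq) = ι l , (begin
      x * ι l                 ≡⟨ *-comm x (ι l) ⟩
      ι l * x                 ≡⟨ ι[k*x] l ⟨
      ι (l ℕ.* toℕ x)         ≡⟨ cong ι eq ⟨
      ι (1 ℕ.+ k ℕ.* p)       ≡⟨ ι-+ 1 (k ℕ.* p) ⟩
      1# + ι (k ℕ.* p)        ≡⟨ cong (1# +_) (ι[k*p]≡0 k) ⟩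
      1# + 0#                 ≡⟨ +-identityʳ 1# ⟩
      1#                      ∎)
    bézout (Bézout.+- k l eq) = - ι l , (begin
      x * - ι l               ≡⟨ solve 2 (λ x l → x :* :- l := con (pos 1) :- (con (pos 1) :+ l :* x)) refl x (ι l) ⟩
      1# - (1# + ι l * x)     ≡⟨ cong (λ y → 1# - (1# + y)) (ι[k*x] l) ⟨
      1# - (1# + ι (l ℕ.* toℕ x))  ≡⟨ cong (λ x → 1# - x) (ι-+ 1 (l ℕ.* toℕ x)) ⟨
      1# - ι (1 ℕ.+ l ℕ.* toℕ x)   ≡⟨ cong (λ n → 1# - ι n) eq ⟩
      1# - ι (k ℕ.* p)        ≡⟨ cong (λ x → 1# - x) (ι[k*p]≡0 k) ⟩
      1# - 0#                 ≡⟨ solve 0 (con (pos 1) :- con (pos 0) := con (pos 1)) refl ⟩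
      1#                      ∎)

  open DiscreteField (ℤ/ p) _≟_ invert

  -- The representatives 0, …, m of the classes {x, - x}.
  ρ : Fin (suc m) → Carrier
  ρ i = ι (toℕ i)

  toℕ≤m : (i : Fin (suc m)) → toℕ i ≤ m
  toℕ≤m i = ℕ.s≤s⁻¹ (toℕ<n i)

  -- Equal squares mean equal or opposite elements. In the opposite case i + j is divisible by p but
  -- at most 2m < p, so i = j = 0.
  ρ²-injective : ∀ i j → ρ i * ρ i ≡ ρ j * ρ j → i ≡ j
  ρ²-injective i j eq = [ same , opposite ]′ (x²≈y²⇒x≈±y eq)
    where
    <p : (k : Fin (suc m)) → toℕ k < p
    <p k = s≤s (ℕ.≤-trans (toℕ≤m k) (ℕ.m≤m+n m m))

    same : ρ i ≡ ρ j → i ≡ j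
    same = toℕ-injective ∘ ι-injective (<p i) (<p j)

    opposite : ρ i ≡ - ρ j → i ≡ j
    opposite ρi≡-ρj = toℕ-injective (trans (ℕ.m+n≡0⇒m≡0 (toℕ i) sum≡0) (sym (ℕ.m+n≡0⇒n≡0 (toℕ i) sum≡0)))
      where
      sum≡0 : toℕ i ℕ.+ toℕ j ≡ 0
      sum≡0 = ι-injective (s≤s (ℕ.+-mono-≤ (toℕ≤m i) (toℕ≤m j))) ℕ.z<s (begin
        ι (toℕ i ℕ.+ toℕ j)  ≡⟨ ι-+ (toℕ i) (toℕ j) ⟩
        ρ i + ρ j            ≡⟨ cong (_+ ρ j) ρi≡-ρj ⟩
        - ρ j + ρ j          ≡⟨ solve 1 (λ x → :- x :+ x := con (pos 0)) refl (ρ j) ⟩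
        0#                   ∎)

  ρ²-covers : ∀ x → ∃[ i ] ρ i * ρ i ≡ x * x
  ρ²-covers x with toℕ x ℕ.≤? m
  ... | yes x≤m = fromℕ< (s≤s x≤m) , cong (λ y → y * y) (trans (cong ι (toℕ-fromℕ< (s≤s x≤m))) (ι-toℕ x))
  ... | no  x≰m = fromℕ< (s≤s p-x≤m) , (begin
    ρ (fromℕ< (s≤s p-x≤m)) * ρ (fromℕ< (s≤s p-x≤m))
      ≡⟨ cong (λ n → ι n * ι n) (toℕ-fromℕ< (s≤s p-x≤m)) ⟩
    -- Negation is defined so that `- x` is `ι (p ∸ toℕ x)`.
    - x * - x
      ≡⟨ solve 1 (λ x → :- x :* :- x := x :* x) refl x ⟩
    x * x  ∎)
    where
    p-x≤m : p ∸ toℕ x ≤ m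
    p-x≤m = ℕ.≤-trans (ℕ.∸-monoʳ-≤ p (ℕ.≰⇒> x≰m)) (ℕ.≤-reflexive (ℕ.m+n∸m≡n m m))

  -- The m + 1 squares and the m + 1 elements - 1 - b² cannot all be distinct.
  a²+b²≡-1 : ∃[ a ] ∃[ b ] a * a + b * b ≡ - 1#
  a²+b²≡-1 = from-collision (pigeonhole p<2m+2 (value ∘ splitAt (suc m)))
    where
    p<2m+2 : p < suc m ℕ.+ suc m
    p<2m+2 = s≤s (ℕ.≤-reflexive (sym (ℕ.+-suc m m)))

    value : Fin (suc m) ⊎ Fin (suc m) → Carrier
    value (inj₁ i) = ρ i * ρ i
    value (inj₂ i) = - 1# - ρ i * ρ i

    goal : ∀ a b → a * a ≡ - 1# - b * b → ∃[ a ] ∃[ b ] a * a + b * b ≡ - 1#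
    goal a b eq = a , b , trans (cong (_+ b * b) eq)
      (solve 1 (λ b → :- con (pos 1) :- b :* b :+ b :* b := :- con (pos 1)) refl b)

    -- Each family has distinct values, so a genuine collision is mixed and reads a² = - 1 - b².
    compare : ∀ k l → value k ≡ value l → k ≡ l ⊎ (∃[ a ] ∃[ b ] a * a + b * b ≡ - 1#)
    compare (inj₁ i) (inj₁ j) eq = inj₁ (cong inj₁ (ρ²-injective i j eq))
    compare (inj₁ i) (inj₂ j) eq = inj₂ (goal (ρ i) (ρ j) eq)
    compare (inj₂ i) (inj₁ j) eq = inj₂ (goal (ρ j) (ρ i) (sym eq))
    compare (inj₂ i) (inj₂ j) eq = inj₁ (cong inj₂ (ρ²-injective i j (begin
      ρ i * ρ i                    ≡⟨ unfold (ρ i) ⟩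
      - 1# - (- 1# - ρ i * ρ i)    ≡⟨ cong (λ x → - 1# - x) eq ⟩
      - 1# - (- 1# - ρ j * ρ j)    ≡⟨ unfold (ρ j) ⟨
      ρ j * ρ j                    ∎)))
      where
      unfold : ∀ x → x * x ≡ - 1# - (- 1# - x * x)
      unfold = solve 1 (λ x → x :* x := :- con (pos 1) :- (:- con (pos 1) :- x :* x)) refl

    from-collision : (∃[ k ] ∃[ l ] k Fin.< l × value (splitAt (suc m) k) ≡ value (splitAt (suc m) l)) →
      ∃[ a ] ∃[ b ] a * a + b * b ≡ - 1#
    from-collision (k , l , k<l , eq) =
      [ (λ same → contradiction (begin
          k                                             ≡⟨ join-splitAt (suc m) (suc m) k ⟨
          join (suc m) (suc m) (splitAt (suc m) k)  ≡⟨ cong (join (suc m) (suc m)) same ⟩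
          join (suc m) (suc m) (splitAt (suc m) l)  ≡⟨ join-splitAt (suc m) (suc m) l ⟩
          l                                             ∎) (<⇒≢ k<l))
      , (λ found → found) ]′ (compare (splitAt (suc m) k) (splitAt (suc m) l) eq)

  -- Inversion on nonzero squares and the quadratic character of - 1.

  r : Fin m → Carrier
  r i = ρ (suc i)

  r²-injective : ∀ i j → r i * r i ≡ r j * r j → i ≡ j
  r²-injective i j eq = suc-injective (ρ²-injective (suc i) (suc j) eq)

  r≢0 : ∀ i → r i ≢ 0#
  r≢0 i ri≡0 = contradiction (ρ²-injective (suc i) zero (cong (λ x → x * x) ri≡0)) λ ()

  r²-covers : ∀ x → x ≢ 0# → ∃[ i ] r i * r i ≡ x * x
  r²-covers x x≢0 = nonzero (ρ²-covers x)
    where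
    nonzero : (∃[ i ] ρ i * ρ i ≡ x * x) → ∃[ i ] r i * r i ≡ x * x
    nonzero (zero  , eq) = contradiction (x*y≈0⇒y≈0 x≢0 (trans (sym eq) (zeroˡ 0#))) x≢0
    nonzero (suc i , eq) = i , eq

  -- Inversion on the classes {x, - x}, expressed through squares so that the choice of sign drops
  -- out.
  Reciprocal : Fin m → Fin m → Set
  Reciprocal i j = r i * r i * (r j * r j) ≡ 1#

  reciprocal-total : ∀ i → ∃[ j ] Reciprocal i j
  reciprocal-total i = j , (begin
    r i * r i * (r j * r j)      ≡⟨ cong (r i * r i *_) rj²≡y² ⟩
    r i * r i * (y * y)          ≡⟨ solve 2 (λ x y → x :* x :* (y :* y) := x :* y :* (x :* y)) refl (r i) y ⟩
    r i * y * (r i * y)          ≡⟨ cong₂ _*_ riy≡1 riy≡1 ⟩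
    1# * 1#                      ≡⟨ *-identityˡ 1# ⟩
    1#                           ∎)
    where
    y = proj₁ (invert (r i) (r≢0 i))
    riy≡1 = proj₂ (invert (r i) (r≢0 i))
    y≢0 : y ≢ 0#
    y≢0 y≡0 = 1≢0 (trans (sym riy≡1) (trans (cong (r i *_) y≡0) (zeroʳ (r i))))
    j = proj₁ (r²-covers y y≢0)
    rj²≡y² = proj₂ (r²-covers y y≢0)

  reciprocal-sym : ∀ i j → Reciprocal i j → Reciprocal j i
  reciprocal-sym i j = trans (*-comm (r j * r j) (r i * r i))

  reciprocal-unique : ∀ i j k → Reciprocal i j → Reciprocal i k → j ≡ k
  reciprocal-unique i j k ij ik = r²-injective j k (begin
    r j * r j                              ≡⟨ *-identityʳ (r j * r j) ⟨
    r j * r j * 1#                         ≡⟨ cong (r j * r j *_) ik ⟨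
    r j * r j * (r i * r i * (r k * r k))  ≡⟨ solve 3 (λ x y z → x :* (y :* z) := y :* x :* z) refl (r j * r j) (r i * r i) (r k * r k) ⟩
    r i * r i * (r j * r j) * (r k * r k)  ≡⟨ cong (_* (r k * r k)) ij ⟩
    1# * (r k * r k)                       ≡⟨ *-identityˡ (r k * r k) ⟩
    r k * r k                              ∎)

  reciprocal : Fin m → Fin m
  reciprocal i = proj₁ (reciprocal-total i)

  reciprocal-correct : ∀ i → Reciprocal i (reciprocal i)
  reciprocal-correct i = proj₂ (reciprocal-total i)

  -- Reciprocity is symmetric and determines the partner uniquely.
  reciprocal-involutive : ∀ i → reciprocal (reciprocal i) ≡ i
  reciprocal-involutive i = reciprocal-unique (reciprocal i) (reciprocal (reciprocal i)) i
    (reciprocal-correct (reciprocal i))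
    (reciprocal-sym i (reciprocal i) (reciprocal-correct i))

  r²≡±1⇒fixed : ∀ {i x} → x * x ≡ 1# → r i * r i ≡ x → reciprocal i ≡ i
  r²≡±1⇒fixed {i} x²≡1 ri²≡x = reciprocal-unique i (reciprocal i) i (reciprocal-correct i)
    (trans (cong₂ _*_ ri²≡x ri²≡x) x²≡1)

  fixed⇒r²≡±1 : ∀ i → reciprocal i ≡ i → r i * r i ≡ 1# ⊎ r i * r i ≡ - 1#
  fixed⇒r²≡±1 i eq = x²≈y²⇒x≈±y (trans (subst (Reciprocal i) eq (reciprocal-correct i)) (sym (*-identityˡ 1#)))

  one : ∃[ i ] r i * r i ≡ 1#
  one = let i , eq = r²-covers 1# 1≢0 in i , trans eq (*-identityˡ 1#)

  one-fixed : reciprocal (proj₁ one) ≡ proj₁ one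
  one-fixed = r²≡±1⇒fixed (*-identityˡ 1#) (proj₂ one)

  r²≡1⇒one : ∀ i → r i * r i ≡ 1# → i ≡ proj₁ one
  r²≡1⇒one i eq = r²-injective i (proj₁ one) (trans eq (sym (proj₂ one)))

  -- The fixed points are the indices of the square roots of 1 and, if there are any, of - 1, so
  -- that m is even exactly when - 1 is a square.
  reciprocal-parity : ∃[ k ] m ≡ k ℕ.+ k ℕ.+ count (λ i → reciprocal i ≟ i)
  reciprocal-parity = involution-parity reciprocal reciprocal-involutive

  -- Exactly two classes are fixed, those of the roots of 1 and of - 1, so m is even.
  -1∈QR⇒p%4≡1 : QuadraticResidue (ℤ/ p) (- 1#) → p % 4 ≡ 1
  -1∈QR⇒p%4≡1 (s , s²≡-1) = trans (cong (λ n → suc (n ℕ.+ n) % 4) m≡2k+2) ([1+2[2k+2]]%4≡1 k)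
    where
    s≢0 : s ≢ 0#
    s≢0 s≡0 = 1≢0 (begin
      1#           ≡⟨ solve 0 (con (pos 1) := :- (:- con (pos 1))) refl ⟩
      - - 1#       ≡⟨ cong -_ (trans (cong₂ _*_ (sym s≡0) (sym s≡0)) s²≡-1) ⟨
      - (0# * 0#)  ≡⟨ solve 0 (:- (con (pos 0) :* con (pos 0)) := con (pos 0)) refl ⟩
      0#           ∎)

    minus-one : ∃[ i ] r i * r i ≡ - 1#
    minus-one = let i , eq = r²-covers s s≢0 in i , trans eq s²≡-1

    one≢minus-one : proj₁ one ≢ proj₁ minus-one
    -- If the two classes coincided, then 1 = - 1.
    one≢minus-one eq = 2≢0 (begin
      1# + 1#      ≡⟨ cong (1# +_) (trans (sym (proj₂ one)) (trans (cong (λ i → r i * r i) eq) (proj₂ minus-one))) ⟩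
      1# + - 1#    ≡⟨ -‿inverseʳ 1# ⟩
      0#           ∎)

    k = proj₁ reciprocal-parity

    m≡2k+2 : m ≡ k ℕ.+ k ℕ.+ 2
    m≡2k+2 = trans (proj₂ reciprocal-parity) (cong (k ℕ.+ k ℕ.+_)
      (count-two (λ i → reciprocal i ≟ i) (proj₁ one) (proj₁ minus-one) one≢minus-one one-fixed
        (r²≡±1⇒fixed (solve 0 (:- con (pos 1) :* :- con (pos 1) := con (pos 1)) refl) (proj₂ minus-one))
        λ i eq → [ inj₁ ∘ r²≡1⇒one i
                 , (λ ri²≡-1 → inj₂ (r²-injective i _ (trans ri²≡-1 (sym (proj₂ minus-one)))))
                 ]′ (fixed⇒r²≡±1 i eq)))

  -- Only the class of the roots of 1 is fixed, so m is odd and p is 3 modulo 4.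
  -1∉QR⇒p%4≢1 : ¬ QuadraticResidue (ℤ/ p) (- 1#) → p % 4 ≢ 1
  -1∉QR⇒p%4≢1 -1∉QR p%4≡1 = contradiction (trans (sym p%4≡1) p%4≡3) λ ()
    where
    k = proj₁ reciprocal-parity

    m≡2k+1 : m ≡ k ℕ.+ k ℕ.+ 1
    m≡2k+1 = trans (proj₂ reciprocal-parity) (cong (k ℕ.+ k ℕ.+_)
      (count-one (λ i → reciprocal i ≟ i) (proj₁ one) one-fixed
        λ i eq → [ r²≡1⇒one i , (λ ri²≡-1 → contradiction (r i , ri²≡-1) -1∉QR) ]′ (fixed⇒r²≡±1 i eq)))

    p%4≡3 : p % 4 ≡ 3
    p%4≡3 = trans (cong (λ n → suc (n ℕ.+ n) % 4) m≡2k+1) ([1+2[2k+1]]%4≡3 k)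

  -- A finite search decides whether - 1 is a square, which fixes the residue of p and selects the
  -- hypothesis on α that the root of - α contradicts.
  -α∉QR : ∀ α → (p % 4 ≡ 1 → ¬ QuadraticResidue (ℤ/ p) α) →
    (p % 4 ≢ 1 → α ≢ 0# × QuadraticResidue (ℤ/ p) α) → ¬ QuadraticResidue (ℤ/ p) (- α)
  -α∉QR α α∉QR p%4≢1⇒ -α∈QR = cases (any? λ i → (i * i) ≟ (- 1#))
    where
    cases : ¬ Dec (QuadraticResidue (ℤ/ p) (- 1#))
    cases (yes -1∈QR) = α∉QR (-1∈QR⇒p%4≡1 -1∈QR) (-1∈QR∧-α∈QR⇒α∈QR α -1∈QR -α∈QR)
    cases (no  -1∉QR) = let α≢0 , α∈QR = p%4≢1⇒ (-1∉QR⇒p%4≢1 -1∉QR) in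
      -1∉QR (α∈QR∧-α∈QR⇒-1∈QR α α≢0 α∈QR -α∈QR)

  -- The exact number of points of the sphere.

  sphere-cardinality : ∀ α → ¬ QuadraticResidue (ℤ/ p) (- α) →
    HasCardinality (AbelianGroup.setoid (Cube (ℤ/ p))) (Sphere (ℤ/ p) α) (p ℕ.* (m ℕ.+ m))
  sphere-cardinality α -α∉QR =
    enumerate , enumerate-injective , λ x → mk⇔ (enumerate-surjective x) (enumerate-sound x)
    where
    open DiscreteField.Parametrisation (ℤ/ p) _≟_ invert 2≢0
      (proj₁ a²+b²≡-1) (proj₁ (proj₂ a²+b²≡-1)) α (proj₂ (proj₂ a²+b²≡-1)) -α∉QR

    -- As `punchIn 0#` skips zero, j runs through the p - 1 = 2m nonzero values of y.
    element : Carrier × Fin (m ℕ.+ m) → Vector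
    element (s , j) = sphere-point s (punchIn 0# j) (punchInᵢ≢i 0# j)

    enumerate : Fin (p ℕ.* (m ℕ.+ m)) → Vector
    enumerate k = element (remQuot {p} (m ℕ.+ m) k)

    ≈ᵥ⇒≡ : ∀ u v → u ≈ᵥ v → u ≡ v
    ≈ᵥ⇒≡ _ _ (p₁ , p₂ , p₃) = cong₂ _,_ p₁ (cong₂ _,_ p₂ p₃)

    element-injective : ∀ k l → element k ≡ element l → k ≡ l
    element-injective (s , i) (t , j) eq = cong₂ _,_
      (trans (sym (s-coord-sphere-point s (punchIn 0# i) (punchInᵢ≢i 0# i)))
        (trans (cong s-coord eq) (s-coord-sphere-point t (punchIn 0# j) (punchInᵢ≢i 0# j))))
      (punchIn-injective 0# i j
        (trans (sym (y-coord-sphere-point s (punchIn 0# i) (punchInᵢ≢i 0# i)))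
          (trans (cong y-coord eq) (y-coord-sphere-point t (punchIn 0# j) (punchInᵢ≢i 0# j)))))

    enumerate-injective : ∀ {k l} → enumerate k ≈ᵥ enumerate l → k ≡ l
    enumerate-injective {k} {l} eq = begin
      k                                           ≡⟨ combine-remQuot {p} (m ℕ.+ m) k ⟨
      uncurry combine (remQuot {p} (m ℕ.+ m) k)
        ≡⟨ cong (uncurry combine) (element-injective (remQuot {p} (m ℕ.+ m) k) (remQuot {p} (m ℕ.+ m) l) (≈ᵥ⇒≡ (enumerate k) (enumerate l) eq)) ⟩
      uncurry combine (remQuot {p} (m ℕ.+ m) l)   ≡⟨ combine-remQuot {p} (m ℕ.+ m) l ⟩
      l                                           ∎

    enumerate-surjective : ∀ x → Sphere (ℤ/ p) α x → ∃[ k ] x ≈ᵥ enumerate k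
    enumerate-surjective x x∈S = combine (s-coord x) j ,
      subst (λ k → x ≈ᵥ element k) (sym (remQuot-combine (s-coord x) j))
        (≈ᵥ-sym {element (s-coord x , j)} {x}
          (sphere-point-coord x x∈S refl (punchIn-punchOut 0≢y) (punchInᵢ≢i 0# j)))
      where
      0≢y : 0# ≢ y-coord x
      0≢y 0≡y = y-coord≉0 x x∈S (sym 0≡y)
      j = punchOut 0≢y

    enumerate-sound : ∀ x → (∃[ k ] x ≈ᵥ enumerate k) → Sphere (ℤ/ p) α x
    enumerate-sound x (k , eq) = Sphere-resp {α} {enumerate k} {x} (≈ᵥ-sym {x} {enumerate k} eq)
      (sphere-point∈sphere s (punchIn 0# j) (punchInᵢ≢i 0# j))
      where
      s = proj₁ (remQuot {p} (m ℕ.+ m) k)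
      j = proj₂ (remQuot {p} (m ℕ.+ m) k)

  -- The two sides are equal, because p - 1 = 2m.
  p²-p≤ : p ^ 2 ∸ p ≤ p ℕ.* (m ℕ.+ m)
  p²-p≤ = ℕ.≤-reflexive (begin
    p ^ 2 ∸ p                      ≡⟨ cong (λ k → p ℕ.* k ∸ p) (ℕ.*-identityʳ p) ⟩
    p ℕ.* p ∸ p                    ≡⟨ cong (_∸ p) (ℕ.*-suc p (m ℕ.+ m)) ⟩
    p ℕ.+ p ℕ.* (m ℕ.+ m) ∸ p      ≡⟨ ℕ.m+n∸m≡n p (p ℕ.* (m ℕ.+ m)) ⟩
    p ℕ.* (m ℕ.+ m)                ∎)

theorem2 : (p : ℕ) .{{_ : NonZero p}} → Prime p → 2 ∤ p →
    (α : CommutativeRing.Carrier (ℤ/ p)) →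
    (p % 4 ≡ 1 → ¬ QuadraticResidue (ℤ/ p) α) →
    (p % 4 ≢ 1 → α ≢ CommutativeRing.0# (ℤ/ p) × QuadraticResidue (ℤ/ p) α) →
    IsC[_,_]-Set (Cube (ℤ/ p)) 3 3 (Sphere (ℤ/ p) α) ×
    CardinalityAtLeast (AbelianGroup.setoid (Cube (ℤ/ p))) (Sphere (ℤ/ p) α) (p ^ 2 ∸ p)
-- Matching on `refl` puts p into the form 1 + 2m required by `OddPrime`.
theorem2 p p-prime 2∤p α nonresidue residue with m , refl ← odd⇒1+2m p 2∤p =
    DiscreteField.sphere-isC₃[3] (ℤ/ p) _≟_ invert 2≢0 -α∉QR′
  , _ , sphere-cardinality α -α∉QR′ , p²-p≤
  where
  open OddPrime m p-prime using (invert; 2≢0; -α∉QR; sphere-cardinality; p²-p≤)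
  -α∉QR′ : ¬ QuadraticResidue (ℤ/ p) (CommutativeRing.-_ (ℤ/ p) α)
  -α∉QR′ = -α∉QR α nonresidue residue
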